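{- The satisfiability problem for synchronous TeamLTL can be reduced, in time linear in the length of the given formula, to the satisfiability problem for $\exists\mathrm{TeamCTL}(\vee_{\mathrm B})$ and to the satisfiability problem for $\forall\mathrm{TeamCTL}(\subseteq)$. Assuming fairness of tefs, this also holds for $\exists\mathrm{TeamCTL}(\mathsf{dep})$, i.e. the satisfiability problem for synchronous TeamLTL can then also be reduced, in time linear in the formula length, to the satisfiability problem for $\exists\mathrm{TeamCTL}(\mathsf{dep})$.
   Context: Fix a set $\mathsf{AP}$ of atomic propositions (fresh propositions may be added). A trace is an infinite sequence $t\in(2^{\mathsf{AP}})^\omega$. A multiset is a set of pairs (index, element) with pairwise distinct indices; the index is usually dropped. $T=T_1\uplus T_2$ means that $T$ is partitioned into $T_1$ and $T_2$ (either may be empty). Tefs: for a multiset of traces $T$ and $\tau\colon\mathbb N\times T\to\mathbb N$, write $\tau(i)=(\tau(i,t))_{t\in T}$; for tuples, $\vec a\le\vec b$ is componentwise, and $\vec a<\vec b$ means $\vec a\le\vec b$ and $\vec a\ne\vec b$. $\tau$ is a tef (time evaluation function) for $T$ if for all $i$: $\tau(i)<\tau(i+1)$ and $\tau(i)\le\tau(i+1)\le\tau(i)+\vec 1$; a stuttering tef if for all $i$: $\tau(i)\le\tau(i+1)\le\tau(i)+\vec 1$; a tef is synchronous if $\tau(i,t)=\tau(i,t')$ for all $i,t,t'$; fair if for all $i\in\mathbb N$ and $t\in T$ there is $j\in\mathbb N$ with $\tau(j,t)\ge i$; initial if $\tau(0,t)=0$ for all $t$. "Assuming fairness of tefs" means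 that only fair tefs are considered. TeamCTL$^*$ formulae: $\varphi ::= p\mid\neg p\mid(\varphi\lor\varphi)\mid(\varphi\land\varphi)\mid\mathsf X\varphi\mid[\varphi\,\mathsf U\,\varphi]\mid[\varphi\,\mathsf W\,\varphi]\mid\exists\varphi\mid\forall\varphi$. TeamLTL: the fragment without $\exists,\forall$. TeamCTL: the fragment in which each temporal operator directly follows a quantifier and vice versa (operators $\mathsf X_\exists,\mathsf X_\forall,\mathsf U_\exists,\mathsf U_\forall,\mathsf W_\exists,\mathsf W_\forall$, e.g. $\mathsf X_\forall\varphi=\forall\mathsf X\varphi$). $\exists$TeamCTL (resp. $\forall$TeamCTL): TeamCTL without the $\forall$-modalities (resp. $\exists$-modalities). Semantics, for $\tau$ a stuttering tef for $T$ and $i\in\mathbb N$: $(T,\tau,i)\models p$ iff $p\in t[\tau(i,t)]$ for all $t\in T$; $(T,\tau,i)\models\neg p$ iff $p\notin t[\tau(i,t)]$ for all $t\in T$; $\land$ is conjunction; $(T,\tau,i)\models(\varphi\lor\psi)$ iff there are $T_1\uplus T_2=T$ with $(T_1,\tau,i)\models\varphi$ and $(T_2,\tau,i)\models\psi$ (with $\tau$ restricted accordingly); $(T,\tau,i)\models\mathsf X\varphi$ iff $(T,\tau,i+1)\models\varphi$; $(T,\tau,i)\models[\varphi\,\mathsf U\,\psi]$ iff there is $k\ge i$ with $(T,\tau,k)\models\psi$ and $(T,\tau,m)\models\varphi$ for all $i\le m<k$; $(T,\tau,i)\models[\varphi\,\mathsf W\,\psi]$ iff for all $k\ge i$, $(T,\tau,k)\models\varphi$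 or there is $m$ with $i\le m\le k$ and $(T,\tau,m)\models\psi$; $(T,\tau,i)\models\exists\varphi$ (resp. $\forall\varphi$) iff $(T,\tau',i)\models\varphi$ for some (resp. all) tef(s) $\tau'$ for $T$ with $\tau'(j,t)=\tau(j,t)$ for all $j\le i$, $t\in T$. Extensions: $L(\mathcal C)$ is $L$ extended with the atoms and connectives in $\mathcal C$. Boolean disjunction $\vee_{\mathrm B}$ (distinct from $\lor$): $(T,\tau,i)\models(\varphi\vee_{\mathrm B}\psi)$ iff $(T,\tau,i)\models\varphi$ or $(T,\tau,i)\models\psi$. For a propositional formula $\psi$, let $[\![\psi]\!]_{(t,m)}$ be its truth value at position $m$ of $t$. Dependence atom: $(T,\tau,i)\models\mathsf{dep}(\varphi_1,\dots,\varphi_n,\psi)$ iff for all $t,t'\in T$, if $[\![\varphi_j]\!]_{(t,\tau(i,t))}=[\![\varphi_j]\!]_{(t',\tau(i,t'))}$ for all $j$, then $[\![\psi]\!]_{(t,\tau(i,t))}=[\![\psi]\!]_{(t',\tau(i,t'))}$ ($n=0$ allowed). Inclusion atom: $(T,\tau,i)\models\varphi_1,\dots,\varphi_n\subseteq\psi_1,\dots,\psi_n$ iff for all $t\in T$ there is $t'\in T$ with $[\![\varphi_j]\!]_{(t,\tau(i,t))}=[\![\psi_j]\!]_{(t',\tau(i,t'))}$ for all $j$. All parameters of atoms are propositional formulae. $T\models_\exists\varphi$ (resp. $T\models_\forall\varphi$) means $(T,\tau,0)\models\varphi$ for some (resp. all) initial tef(s) $\tau$ for $T$. $T\models_s\varphi$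 means $(T,\tau,0)\models\varphi$ for the unique initial synchronous tef $\tau$ for $T$. "Synchronous TeamLTL" is TeamLTL under $\models_s$. The satisfiability problem: given a formula $\varphi$, is there a multiset of traces $T$ with $T\models_*\varphi$? Here $\models_*$ is $\models_s$ for synchronous TeamLTL, $\models_\exists$ for extensions of $\exists$TeamCTL and $\models_\forall$ for extensions of $\forall$TeamCTL.
   Formalization: Satisfiability is taken to mean satisfiability by a nonempty multiset of traces: the empty multiset has no tef, so it would vacuously satisfy every formula under ⊨∀ and make the reduction to ∀TeamCTL(⊆) false. -}

module Defs where

open import Level using (0ℓ)
open import Data.Bool.Base as Bool using (Bool; true; false)
open import Data.Fin.Base using (Fin)
open import Data.List.Base as List using (List; []; _∷_; _++_; length; reverse; replicate)
open import Data.List.Relation.Unary.All using (All)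
open import Data.Maybe.Base as Maybe using (Maybe; just; nothing)
open import Data.Nat.Base using (ℕ; zero; suc; _+_; _*_; _≤_; _<_)
open import Data.Product.Base using (Σ; Σ-syntax; ∃; ∃-syntax; _×_; _,_; proj₁)
open import Data.Sum.Base using (_⊎_; inj₁; inj₂)
open import Data.Vec.Base as Vec using (Vec; []; _∷_)
open import Function.Bundles using (_⇔_; _↔_)
open import Relation.Binary.PropositionalEquality using (_≡_)
open import Relation.Nullary.Negation using (¬_)
open import Relation.Unary using (Pred; _∈_)

------------------------------------------------------------------------
-- Syntax

-- Countably many propositions, named by binary words so that formulae can
-- be written over a finite alphabet; fresh ones are always available.
AP : Set
AP = List Bool

data PropFormula : Set where
  var     : AP → PropFormula
  not     : PropFormula → PropFormula
  _∧_ _∨_ : PropFormula → PropFormula → PropFormula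

data Quantifier : Set where
  some all : Quantifier

-- TeamCTL* together with all the extensions; the individual logics are the
-- fragments below.  _∨_ is the splitting disjunction, _∨ᴮ_ the Boolean one.
data Formula : Set where
  pos neg     : AP → Formula
  _∨_ _∧_     : Formula → Formula → Formula
  X           : Formula → Formula
  _U_ _W_     : Formula → Formula → Formula
  quant       : Quantifier → Formula → Formula
  _∨ᴮ_        : Formula → Formula → Formula
  dep         : List PropFormula → PropFormula → Formula
  _⊆_         : ∀ {n} → Vec PropFormula (suc n) → Vec PropFormula (suc n) → Formula

data TeamLTL : Formula → Set where
  pos : ∀ p → TeamLTL (pos p)
  neg : ∀ p → TeamLTL (neg p)
  _∨_ : ∀ {φ ψ} → TeamLTL φ → TeamLTL ψ → TeamLTL (φ ∨ ψ)
  _∧_ : ∀ {φ ψ} → TeamLTL φ → TeamLTL ψ → TeamLTL (φ ∧ ψ)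
  X   : ∀ {φ} → TeamLTL φ → TeamLTL (X φ)
  _U_ : ∀ {φ ψ} → TeamLTL φ → TeamLTL ψ → TeamLTL (φ U ψ)
  _W_ : ∀ {φ ψ} → TeamLTL φ → TeamLTL ψ → TeamLTL (φ W ψ)

data Extension : Set where
  booleanDisjunction dependence inclusion : Extension

-- TeamCTL(C) with only the modalities X_q, U_q, W_q for q ∈ Q.
data TeamCTL (Q : Pred Quantifier 0ℓ) (C : Pred Extension 0ℓ) : Formula → Set where
  pos  : ∀ p → TeamCTL Q C (pos p)
  neg  : ∀ p → TeamCTL Q C (neg p)
  _∨_  : ∀ {φ ψ} → TeamCTL Q C φ → TeamCTL Q C ψ → TeamCTL Q C (φ ∨ ψ)
  _∧_  : ∀ {φ ψ} → TeamCTL Q C φ → TeamCTL Q C ψ → TeamCTL Q C (φ ∧ ψ)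
  X    : ∀ {q φ} → q ∈ Q → TeamCTL Q C φ → TeamCTL Q C (quant q (X φ))
  U    : ∀ {q φ ψ} → q ∈ Q → TeamCTL Q C φ → TeamCTL Q C ψ → TeamCTL Q C (quant q (φ U ψ))
  W    : ∀ {q φ ψ} → q ∈ Q → TeamCTL Q C φ → TeamCTL Q C ψ → TeamCTL Q C (quant q (φ W ψ))
  or   : ∀ {φ ψ} → booleanDisjunction ∈ C →
         TeamCTL Q C φ → TeamCTL Q C ψ → TeamCTL Q C (φ ∨ᴮ ψ)
  dep  : dependence ∈ C → ∀ φs ψ → TeamCTL Q C (dep φs ψ)
  inc  : inclusion ∈ C → ∀ {n} (φs ψs : Vec PropFormula (suc n)) → TeamCTL Q C (φs ⊆ ψs)

∃TeamCTL ∀TeamCTL : Pred Extension 0ℓ → Formula → Set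
∃TeamCTL = TeamCTL (some ≡_)
∀TeamCTL = TeamCTL (all ≡_)

------------------------------------------------------------------------
-- Teams and time evaluation functions

Trace : Set
Trace = ℕ → AP → Bool

-- A multiset of traces.
record Team : Set₁ where
  field
    Index : Set
    trace : Index → Trace

open Team public

Nonempty : Team → Set
Nonempty T = Index T

-- The characteristic function s splits T into T ↾ s ∷= true and
-- T ↾ s ∷= false, either of which may be empty.
_↾_∷=_ : (T : Team) → (Index T → Bool) → Bool → Team
T ↾ s ∷= b = record
  { Index = Σ[ t ∈ Index T ] s t ≡ b
  ; trace = λ t → trace T (proj₁ t)
  }

TimeFunction : Team → Set
TimeFunction T = ℕ → Index T → ℕ

restrict : ∀ {T} → TimeFunction T → ∀ s b → TimeFunction (T ↾ s ∷= b)
restrict τ s b i t = τ i (proj₁ t)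

infix 4 _≤ᵛ_ _<ᵛ_

_≤ᵛ_ : {I : Set} → (I → ℕ) → (I → ℕ) → Set
a ≤ᵛ b = ∀ t → a t ≤ b t

-- No function extensionality is assumed, so tuples are compared pointwise.
_<ᵛ_ : {I : Set} → (I → ℕ) → (I → ℕ) → Set
a <ᵛ b = a ≤ᵛ b × ¬ (∀ t → a t ≡ b t)

-- When T is empty the strictness condition fails: an empty team has no tef.
IsTef : (T : Team) → TimeFunction T → Set
IsTef T τ = ∀ i →
  τ i <ᵛ τ (suc i) × τ i ≤ᵛ τ (suc i) × τ (suc i) ≤ᵛ (λ t → τ i t + 1)

Synchronous : (T : Team) → TimeFunction T → Set
Synchronous T τ = ∀ i t t′ → τ i t ≡ τ i t′

Fair : (T : Team) → TimeFunction T → Set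
Fair T τ = ∀ i t → ∃[ j ] i ≤ τ j t

Initial : (T : Team) → TimeFunction T → Set
Initial T τ = ∀ t → τ 0 t ≡ 0

-- Whether fairness of tefs is assumed.
data Mode : Set where
  unrestricted fair : Mode

Tef : Mode → (T : Team) → TimeFunction T → Set
Tef unrestricted T τ = IsTef T τ
Tef fair         T τ = IsTef T τ × Fair T τ

AgreeUpTo : ∀ {T} → ℕ → TimeFunction T → TimeFunction T → Set
AgreeUpTo i τ τ′ = ∀ j → j ≤ i → ∀ t → τ′ j t ≡ τ j t

------------------------------------------------------------------------
-- Semantics

⟦_⟧ : PropFormula → Trace → ℕ → Bool
⟦ var p ⟧ t m = t m p
⟦ not φ ⟧ t m = Bool.not (⟦ φ ⟧ t m)
⟦ φ ∧ ψ ⟧ t m = ⟦ φ ⟧ t m Bool.∧ ⟦ ψ ⟧ t m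
⟦ φ ∨ ψ ⟧ t m = ⟦ φ ⟧ t m Bool.∨ ⟦ ψ ⟧ t m

-- The time function reached in a subformula of a formula evaluated at a tef
-- is a restriction of a tef to a subteam, hence a stuttering tef.
infix 4 ⟨_,_,_⟩⊨[_]_

⟨_,_,_⟩⊨[_]_ : (T : Team) → TimeFunction T → ℕ → Mode → Formula → Set
⟨ T , τ , i ⟩⊨[ m ] pos p = ∀ t → trace T t (τ i t) p ≡ true
⟨ T , τ , i ⟩⊨[ m ] neg p = ∀ t → trace T t (τ i t) p ≡ false
⟨ T , τ , i ⟩⊨[ m ] (φ ∨ ψ) = ∃[ s ]
  (⟨ T ↾ s ∷= true  , restrict {T} τ s true  , i ⟩⊨[ m ] φ) ×
  (⟨ T ↾ s ∷= false , restrict {T} τ s false , i ⟩⊨[ m ] ψ)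
⟨ T , τ , i ⟩⊨[ m ] (φ ∧ ψ) = (⟨ T , τ , i ⟩⊨[ m ] φ) × (⟨ T , τ , i ⟩⊨[ m ] ψ)
⟨ T , τ , i ⟩⊨[ m ] X φ = ⟨ T , τ , suc i ⟩⊨[ m ] φ
⟨ T , τ , i ⟩⊨[ m ] (φ U ψ) = ∃[ k ] i ≤ k ×
  (⟨ T , τ , k ⟩⊨[ m ] ψ) ×
  (∀ l → i ≤ l → l < k → ⟨ T , τ , l ⟩⊨[ m ] φ)
⟨ T , τ , i ⟩⊨[ m ] (φ W ψ) = ∀ k → i ≤ k →
  (⟨ T , τ , k ⟩⊨[ m ] φ) ⊎
  (∃[ l ] i ≤ l × l ≤ k × (⟨ T , τ , l ⟩⊨[ m ] ψ))
⟨ T , τ , i ⟩⊨[ m ] quant some φ =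
  ∃[ τ′ ] Tef m T τ′ × AgreeUpTo {T} i τ τ′ × (⟨ T , τ′ , i ⟩⊨[ m ] φ)
⟨ T , τ , i ⟩⊨[ m ] quant all φ =
  ∀ τ′ → Tef m T τ′ → AgreeUpTo {T} i τ τ′ → ⟨ T , τ′ , i ⟩⊨[ m ] φ
⟨ T , τ , i ⟩⊨[ m ] (φ ∨ᴮ ψ) = (⟨ T , τ , i ⟩⊨[ m ] φ) ⊎ (⟨ T , τ , i ⟩⊨[ m ] ψ)
⟨ T , τ , i ⟩⊨[ m ] dep φs ψ = ∀ t t′ →
  All (λ φ → ⟦ φ ⟧ (trace T t) (τ i t) ≡ ⟦ φ ⟧ (trace T t′) (τ i t′)) φs →
  ⟦ ψ ⟧ (trace T t) (τ i t) ≡ ⟦ ψ ⟧ (trace T t′) (τ i t′)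
⟨ T , τ , i ⟩⊨[ m ] (φs ⊆ ψs) = ∀ t → ∃[ t′ ] ∀ j →
  ⟦ Vec.lookup φs j ⟧ (trace T t) (τ i t) ≡ ⟦ Vec.lookup ψs j ⟧ (trace T t′) (τ i t′)

_⊨∃[_]_ _⊨∀[_]_ _⊨s[_]_ : Team → Mode → Formula → Set
T ⊨∃[ m ] φ = ∃[ τ ] Tef m T τ × Initial T τ × (⟨ T , τ , 0 ⟩⊨[ m ] φ)
T ⊨∀[ m ] φ = ∀ τ → Tef m T τ → Initial T τ → ⟨ T , τ , 0 ⟩⊨[ m ] φ
-- On a nonempty team the initial synchronous tef exists and is unique.
T ⊨s[ m ] φ =
  ∃[ τ ] Tef m T τ × Initial T τ × Synchronous T τ × (⟨ T , τ , 0 ⟩⊨[ m ] φ)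

------------------------------------------------------------------------
-- Formulae as words

data Symbol : Set where
  bit                       : Bool → Symbol
  end pos neg ∧ˢ ∨ˢ Xˢ Uˢ Wˢ : Symbol
  quant                     : Quantifier → Symbol
  ∨ᴮˢ depˢ ⊆ˢ               : Symbol

Word : Set
Word = List Symbol

-- Prefix notation.  Every encoding is self-delimiting, no encoding of a
-- propositional formula begins with end, and so the encodings are injective.
encodeAP : AP → Word
encodeAP p = List.map bit p ++ end ∷ []

encodeProp : PropFormula → Word
encodeProp (var p) = pos ∷ encodeAP p
encodeProp (not φ) = neg ∷ encodeProp φ
encodeProp (φ ∧ ψ) = ∧ˢ ∷ encodeProp φ ++ encodeProp ψ
encodeProp (φ ∨ ψ) = ∨ˢ ∷ encodeProp φ ++ encodeProp ψ

encodeProps : List PropFormula → Word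
encodeProps φs = List.concatMap encodeProp φs ++ end ∷ []

encode : Formula → Word
encode (pos p)     = pos ∷ encodeAP p
encode (neg p)     = neg ∷ encodeAP p
encode (φ ∨ ψ)     = ∨ˢ ∷ encode φ ++ encode ψ
encode (φ ∧ ψ)     = ∧ˢ ∷ encode φ ++ encode ψ
encode (X φ)       = Xˢ ∷ encode φ
encode (φ U ψ)     = Uˢ ∷ encode φ ++ encode ψ
encode (φ W ψ)     = Wˢ ∷ encode φ ++ encode ψ
encode (quant q φ) = quant q ∷ encode φ
encode (φ ∨ᴮ ψ)    = ∨ᴮˢ ∷ encode φ ++ encode ψ
encode (dep φs ψ)  = depˢ ∷ encodeProps φs ++ encodeProp ψ
encode (φs ⊆ ψs)   = ⊆ˢ ∷ encodeProps (Vec.toList φs) ++ encodeProps (Vec.toList ψs)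

------------------------------------------------------------------------
-- Deterministic multitape Turing machines

data Move : Set where
  left stay right : Move

-- A two-way infinite tape: before lists the cells left of the head, nearest
-- first; all cells beyond the two lists are blank.
record Tape (Γ : Set) : Set where
  constructor ⟪_,_,_⟫
  field
    before  : List Γ
    scanned : Γ
    after   : List Γ

open Tape public

-- The first of the 2 + work tapes holds the input, the second the output.
-- The tape alphabet consists of a blank (nothing), the symbols in which
-- formulae are written, and finitely many auxiliary symbols.
record TuringMachine : Set₁ where
  field
    State  : Set
    finite : ∃[ n ] State ↔ Fin n
    start  : State
    aux    : ℕ
    work   : ℕ

  Γ : Set
  Γ = Maybe (Symbol ⊎ Fin aux)

  -- δ returns nothing when the machine halts.
  field
    δ : State → Vec Γ (2 + work) → Maybe (State × Vec (Γ × Move) (2 + work))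

module _ (M : TuringMachine) where
  open TuringMachine M

  Configuration : Set
  Configuration = State × Vec (Tape Γ) (2 + work)

  blank : Γ
  blank = nothing

  symbol : Symbol → Γ
  symbol a = just (inj₁ a)

  move : Move → Tape Γ → Tape Γ
  move left  ⟪ []     , a , as ⟫ = ⟪ [] , blank , a ∷ as ⟫
  move left  ⟪ b ∷ bs , a , as ⟫ = ⟪ bs , b , a ∷ as ⟫
  move stay  tape                = tape
  move right ⟪ bs , a , []     ⟫ = ⟪ a ∷ bs , blank , [] ⟫
  move right ⟪ bs , a , c ∷ cs ⟫ = ⟪ a ∷ bs , c , cs ⟫

  act : Γ × Move → Tape Γ → Tape Γ
  act (a , d) ⟪ bs , _ , as ⟫ = move d ⟪ bs , a , as ⟫

  step : Configuration → Maybe Configuration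
  step (q , tapes) = Maybe.map
    (λ (q′ , actions) → q′ , Vec.zipWith act actions tapes)
    (δ q (Vec.map scanned tapes))

  data _⟶[_]_ : Configuration → ℕ → Configuration → Set where
    done : ∀ {c} → c ⟶[ 0 ] c
    next : ∀ {c c′ c″ n} → step c ≡ just c′ → c′ ⟶[ n ] c″ → c ⟶[ suc n ] c″

  Halted : Configuration → Set
  Halted c = step c ≡ nothing

  blankTape : Tape Γ
  blankTape = ⟪ [] , blank , [] ⟫

  inputTape : Word → Tape Γ
  inputTape []      = blankTape
  inputTape (a ∷ w) = ⟪ [] , symbol a , List.map symbol w ⟫

  initial : Word → Configuration
  initial w = start , inputTape w ∷ blankTape ∷ Vec.replicate work blankTape

  -- The tape contains the word v and is blank otherwise.
  Contains : Tape Γ → Word → Set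
  Contains ⟪ bs , a , as ⟫ v = ∃[ k ] ∃[ l ]
    reverse bs ++ a ∷ as ≡ replicate k blank ++ List.map symbol v ++ replicate l blank

  Output : Configuration → Word → Set
  Output (_ , _ ∷ out ∷ _) v = Contains out v

  -- Started on w, the machine halts within b steps with output v.
  Computes : Word → Word → ℕ → Set
  Computes w v b = ∃[ n ] ∃[ c ] n ≤ b × (initial w ⟶[ n ] c) × Halted c × Output c v

------------------------------------------------------------------------
-- Satisfiability problems and reductions

record Problem : Set₂ where
  field
    Instance    : Formula → Set
    Satisfiable : Formula → Set₁

-- Satisfiability is satisfiability by a nonempty team; with the empty team,
-- which has no tef, every formula would be satisfiable under ⊨∀.
SyncTeamLTL-SAT : Mode → Problem
SyncTeamLTL-SAT m = record
  { Instance    = TeamLTL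
  ; Satisfiable = λ φ → ∃[ T ] Nonempty T × (T ⊨s[ m ] φ)
  }

∃TeamCTL-SAT ∀TeamCTL-SAT : Mode → Pred Extension 0ℓ → Problem
∃TeamCTL-SAT m C = record
  { Instance    = ∃TeamCTL C
  ; Satisfiable = λ φ → ∃[ T ] Nonempty T × (T ⊨∃[ m ] φ)
  }
∀TeamCTL-SAT m C = record
  { Instance    = ∀TeamCTL C
  ; Satisfiable = λ φ → ∃[ T ] Nonempty T × (T ⊨∀[ m ] φ)
  }

-- Many-one reducibility in linear time; every encoding of a formula is a
-- nonempty word, so no additive constant is needed in the time bound.
infix 4 _≤ˡⁱⁿ_

_≤ˡⁱⁿ_ : Problem → Problem → Set₁
P ≤ˡⁱⁿ Q =
  Σ[ M ∈ TuringMachine ] ∃[ c ] ∀ φ → Instance P φ →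
  ∃[ ψ ] Instance Q ψ ×
         Computes M (encode φ) (encode ψ) (c * length (encode φ)) ×
         (Satisfiable P φ ⇔ Satisfiable Q ψ)
  where open Problem

{-# OPTIONS --safe #-}
module Submission where

-- Synchronous TeamLTL is downward closed, so satisfiability amounts to LTL
-- satisfiability by a single trace, on which the only tef is synchronous.  For
-- ∀TeamCTL it suffices to write ∀ before each temporal operator, as the
-- synchronous tef is among the tefs quantified over.  For ∃TeamCTL a fresh
-- clock forces the chosen tefs to be synchronous: it flips at every position of
-- every trace, and all traces are required to agree on it at every step.  As
-- some trace advances in each step, they then all do.
--
-- In prefix notation all these translations are homomorphisms of words preceded
-- by a constant word, hence computable in linear time.

open import Level using (0ℓ)
open import Axiom.ExcludedMiddle using (ExcludedMiddle)
open import Data.Bool.Base as Bool using (Bool; true; false)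
open import Data.Bool.Properties using (not-¬; not-involutive)
open import Data.Fin using (Fin; toℕ; #_)
open import Data.Fin.Properties using (toℕ-fromℕ<)
open import Data.List.Base as List using (List; []; _∷_; _++_; length; drop; reverse; _ʳ++_; concatMap)
open import Data.List.Properties using (length-++; ++-assoc; ++-ʳ++; reverse-involutive; map-++; concatMap-++)
open import Data.List.Membership.Propositional using (_∈_)
open import Data.List.Membership.Propositional.Properties using (∈-lookup)
open import Data.List.Relation.Unary.All using ([])
open import Data.List.Relation.Unary.Any using (here; there)
open import Data.Maybe.Base using (Maybe; just; nothing; is-just; fromMaybe)
open import Data.Nat.Base
open import Data.Nat.DivMod using (_mod_; m<n⇒m%n≡m)
open import Data.Nat.Properties
open import Data.Product.Base using (∃-syntax; _×_; _,_; proj₁; proj₂)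
open import Data.Sum.Base using (_⊎_; inj₁; inj₂)
open import Data.Unit.Base using (⊤; tt)
open import Data.Vec.Base using (Vec; []; _∷_)
open import Function.Bundles using (_⇔_; mk⇔; Equivalence)
open import Function.Construct.Identity using (↔-id)
open import Relation.Binary.PropositionalEquality
open import Relation.Nullary using (¬_; yes; no; contradiction)
open import Relation.Unary as Unary using (Pred; ｛_｝)
open import Defs hiding (U; W)

-- Computing homomorphisms of words

symbols : List Symbol
symbols = bit true ∷ bit false ∷ end ∷ pos ∷ neg ∷ ∧ˢ ∷ ∨ˢ ∷ Xˢ ∷ Uˢ ∷ Wˢ ∷
          quant some ∷ quant all ∷ ∨ᴮˢ ∷ depˢ ∷ ⊆ˢ ∷ []

∈-symbols : ∀ a → a ∈ symbols
∈-symbols (bit true)   = ∈-lookup {xs = symbols} (# 0)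
∈-symbols (bit false)  = ∈-lookup {xs = symbols} (# 1)
∈-symbols end          = ∈-lookup {xs = symbols} (# 2)
∈-symbols pos          = ∈-lookup {xs = symbols} (# 3)
∈-symbols neg          = ∈-lookup {xs = symbols} (# 4)
∈-symbols ∧ˢ           = ∈-lookup {xs = symbols} (# 5)
∈-symbols ∨ˢ           = ∈-lookup {xs = symbols} (# 6)
∈-symbols Xˢ           = ∈-lookup {xs = symbols} (# 7)
∈-symbols Uˢ           = ∈-lookup {xs = symbols} (# 8)
∈-symbols Wˢ           = ∈-lookup {xs = symbols} (# 9)
∈-symbols (quant some) = ∈-lookup {xs = symbols} (# 10)
∈-symbols (quant all)  = ∈-lookup {xs = symbols} (# 11)
∈-symbols ∨ᴮˢ          = ∈-lookup {xs = symbols} (# 12)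
∈-symbols depˢ         = ∈-lookup {xs = symbols} (# 13)
∈-symbols ⊆ˢ           = ∈-lookup {xs = symbols} (# 14)

length-concatMap-∈ : ∀ (f : Symbol → Word) {a as} → a ∈ as →
                     length (f a) ≤ length (concatMap f as)
length-concatMap-∈ f {a} {.a ∷ as} (here refl)
  rewrite length-++ (f a) {concatMap f as} = m≤m+n _ _
length-concatMap-∈ f {a} {b ∷ as} (there a∈as)
  rewrite length-++ (f b) {concatMap f as} =
  ≤-trans (length-concatMap-∈ f a∈as) (m≤n+m _ _)

drop-∷ : ∀ {A : Set} n {xs ys : List A} {y} → drop n xs ≡ y ∷ ys →
         n < length xs × drop (suc n) xs ≡ ys
drop-∷ zero    {_ ∷ _} refl = z<s , refl
drop-∷ (suc n) {_ ∷ _} eq   = let n< , eq′ = drop-∷ n eq in s<s n< , eq′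

drop-length-++ : ∀ {A : Set} (xs ys : List A) → drop (length xs) (xs ++ ys) ≡ ys
drop-length-++ []       ys = refl
drop-length-++ (x ∷ xs) ys = drop-length-++ xs ys

module Homomorphism (w₀ : Word) (h : Symbol → Word) where

  answer : Symbol → Word
  answer a = w₀ ++ h a

  -- A sum in place of a maximum: it dominates the length of each answer, so a counter with
  -- `suc bound` values can point anywhere in an answer, its end included.
  bound : ℕ
  bound = length (concatMap answer symbols)

  answer-bounded : ∀ a → length (answer a) ≤ bound
  answer-bounded a = length-concatMap-∈ answer (∈-symbols a)

  private
    State = Fin (suc bound)

    Γ = Maybe (Symbol ⊎ Fin 0)

  respond : State → Symbol → Γ → Word → State × Vec (Γ × Move) 2
  respond q a b []      =
    (length w₀ mod suc bound) , (just (inj₁ a) , right) ∷ (b , stay) ∷ []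
  respond q a b (c ∷ _) =
    (suc (toℕ q) mod suc bound) , (just (inj₁ a) , stay) ∷ (just (inj₁ c) , right) ∷ []

  -- In state q over the input symbol a, the machine has already written the
  -- first q symbols of w₀ ++ h a; for all but the first input symbol it
  -- starts at q = length w₀.
  machine : TuringMachine
  machine = record
    { State  = State
    ; finite = suc bound , ↔-id _
    ; start  = Fin.zero
    ; aux    = 0
    ; work   = 0
    ; δ      = δ
    }
    where
    δ : State → Vec Γ 2 → Maybe (State × Vec (Γ × Move) 2)
    δ q (just (inj₁ a) ∷ b ∷ []) = just (respond q a b (drop (toℕ q) (answer a)))
    δ q (nothing       ∷ _)      = nothing

  private
    Steps = _⟶[_]_ machine

  in-tape : List Γ → Word → Tape Γ
  in-tape l []      = ⟪ l , nothing , [] ⟫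
  in-tape l (a ∷ w) = ⟪ l , symbol machine a , List.map (symbol machine) w ⟫

  out-tape : List Γ → Tape Γ
  out-tape r = ⟪ r , nothing , [] ⟫

  config : State → List Γ → Word → List Γ → Configuration machine
  config q l w r = q , in-tape l w ∷ out-tape r ∷ []

  ⟶-trans : ∀ {c c′ c″ m n} → Steps c m c′ → Steps c′ n c″ → Steps c (m + n) c″
  ⟶-trans done         st = st
  ⟶-trans (next eq st) st′ = next eq (⟶-trans st st′)

  symbolwise : Word → List Γ
  symbolwise = List.map (symbol machine)

  toℕ-mod : ∀ {n} → n ≤ bound → toℕ (n mod suc bound) ≡ n
  toℕ-mod n≤ = trans (toℕ-fromℕ< _) (m<n⇒m%n≡m (s≤s n≤))

  ready : State
  ready = length w₀ mod suc bound

  advance-input : ∀ l a w →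
    move machine right (in-tape l (a ∷ w)) ≡ in-tape (symbol machine a ∷ l) w
  advance-input l a []      = refl
  advance-input l a (_ ∷ _) = refl

  -- Induction on the unwritten rest `v` of the answer: one step per symbol and a last one to
  -- advance the input head. The tape left of the head is stored nearest first, hence `ʳ++`.
  emit : ∀ q l a w r v → drop (toℕ q) (answer a) ≡ v →
    Steps (config q l (a ∷ w) r) (suc (length v))
          (config ready (symbol machine a ∷ l) w (symbolwise v ʳ++ r))
  emit q l a w r []      eq = next step≡ done
    where
    step≡ : step machine (config q l (a ∷ w) r) ≡
            just (config ready (symbol machine a ∷ l) w r)
    step≡ rewrite eq | advance-input l a w = refl
  emit q l a w r (c ∷ v) eq =
    next step≡ (emit q′ l a w (symbol machine c ∷ r) v drop≡)
    where
    q′ : State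
    q′ = suc (toℕ q) mod suc bound
    step≡ : step machine (config q l (a ∷ w) r) ≡
            just (config q′ l (a ∷ w) (symbol machine c ∷ r))
    step≡ rewrite eq = refl
    drop≡ : drop (toℕ q′) (answer a) ≡ v
    drop≡ = let q< , eq′ = drop-∷ (toℕ q) eq in
      trans (cong (λ n → drop n (answer a))
                  (toℕ-mod (≤-trans q< (answer-bounded a)))) eq′

  drop-ready : ∀ a → drop (toℕ ready) (answer a) ≡ h a
  drop-ready a = trans
    (cong (λ n → drop n (answer a)) (toℕ-mod (≤-trans w₀≤ (answer-bounded a))))
    (drop-length-++ w₀ (h a))
    where
    w₀≤ : length w₀ ≤ length (answer a)
    w₀≤ rewrite length-++ w₀ {h a} = m≤m+n _ _

  symbolwise-ʳ++ : ∀ v v′ r →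
    symbolwise (v ++ v′) ʳ++ r ≡ symbolwise v′ ʳ++ (symbolwise v ʳ++ r)
  symbolwise-ʳ++ v v′ r =
    trans (cong (_ʳ++ r) (map-++ _ v v′)) (++-ʳ++ (symbolwise v))

  length-h : ∀ a → length (h a) ≤ bound
  length-h a = ≤-trans h≤ (answer-bounded a)
    where
    h≤ : length (h a) ≤ length (answer a)
    h≤ rewrite length-++ w₀ {h a} = m≤n+m _ _

  consume : ∀ l w r → ∃[ n ] ∃[ l′ ] n ≤ suc bound * length w ×
    Steps (config ready l w r) n (config ready l′ [] (symbolwise (concatMap h w) ʳ++ r))
  consume l []      r = 0 , l , z≤n , done
  consume l (a ∷ w) r =
    let n , l′ , n≤ , st = consume (symbol machine a ∷ l) w (symbolwise (h a) ʳ++ r)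
    in suc (length (h a)) + n , l′ ,
       subst (suc (length (h a)) + n ≤_) (sym (*-suc (suc bound) (length w)))
         (+-mono-≤ (s≤s (length-h a)) n≤) ,
       ⟶-trans (emit ready l a w r (h a) (drop-ready a))
         (subst (λ r′ → Steps (config ready _ w (symbolwise (h a) ʳ++ r)) n (config ready l′ [] r′))
           (sym (symbolwise-ʳ++ (h a) (concatMap h w) r)) st)

  computes : ∀ a w → Computes machine (a ∷ w) (w₀ ++ concatMap h (a ∷ w))
                              (suc bound * length (a ∷ w))
  computes a w =
    -- The first symbol is processed from state zero, so its answer includes `w₀`; `consume` handles
    -- the rest.
    let n , l , n≤ , st = consume (symbol machine a ∷ []) w (symbolwise (answer a) ʳ++ []) in
    suc (length (answer a)) + n , config ready l [] _ ,
    subst (suc (length (answer a)) + n ≤_) (sym (*-suc (suc bound) (length w)))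
      (+-mono-≤ (s≤s (answer-bounded a)) n≤) ,
    ⟶-trans (emit Fin.zero [] a w [] (answer a) refl) st ,
    -- No blank precedes the output, and one follows it: the cell under the head.
    refl , 0 , 1 , output
    where
    open ≡-Reasoning
    output : reverse (symbolwise (concatMap h w) ʳ++ (symbolwise (answer a) ʳ++ [])) ++ nothing ∷ []
           ≡ symbolwise (w₀ ++ concatMap h (a ∷ w)) ++ nothing ∷ []
    output = cong (_++ nothing ∷ []) (begin
      reverse (symbolwise (concatMap h w) ʳ++ (symbolwise (answer a) ʳ++ []))
        ≡⟨ cong reverse (symbolwise-ʳ++ (answer a) (concatMap h w) []) ⟨
      reverse (reverse (symbolwise (answer a ++ concatMap h w)))
        ≡⟨ reverse-involutive _ ⟩
      symbolwise (answer a ++ concatMap h w)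
        ≡⟨ cong symbolwise (++-assoc w₀ (h a) (concatMap h w)) ⟩
      symbolwise (w₀ ++ concatMap h (a ∷ w)) ∎)

-- Synchronous tefs and LTL

holds : ∀ {φ} → TeamLTL φ → Trace → ℕ → Set
holds (pos p) u i = u i p ≡ true
holds (neg p) u i = u i p ≡ false
holds (d ∨ e) u i = holds d u i ⊎ holds e u i
holds (d ∧ e) u i = holds d u i × holds e u i
holds (X d)   u i = holds d u (suc i)
holds (d U e) u i = ∃[ k ] i ≤ k × holds e u k × (∀ l → i ≤ l → l < k → holds d u l)
holds (d W e) u i = ∀ k → i ≤ k → holds d u k ⊎ (∃[ l ] i ≤ l × l ≤ k × holds e u l)

-- Stated for one time `i`, so that synchrony can be propagated step by step.
Synced : (T : Team) → TimeFunction T → ℕ → Set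
Synced T τ i = ∀ t → τ i t ≡ i

tef⇒isTef : ∀ m {T τ} → Tef m T τ → IsTef T τ
tef⇒isTef unrestricted tef       = tef
tef⇒isTef fair         (tef , _) = tef

-- On an empty team all tuples are equal, against strictness; excluded middle turns this refutation
-- into a trace.
tef-nonempty : ExcludedMiddle 0ℓ → ∀ {T τ} → IsTef T τ → Index T
tef-nonempty em {T} tef with em {Index T}
... | yes t  = t
... | no ¬t = contradiction (λ t → contradiction t ¬t) (proj₂ (proj₁ (tef 0)))

tef-step : ∀ {T τ} → IsTef T τ → ∀ i t → τ (suc i) t ≡ τ i t ⊎ τ (suc i) t ≡ suc (τ i t)
tef-step {τ = τ} tef i t with m≤n⇒m<n∨m≡n (proj₁ (proj₁ (tef i)) t)
... | inj₁ lt = inj₂ (≤-antisym (subst (τ (suc i) t ≤_) (+-comm _ 1) (proj₂ (proj₂ (tef i)) t)) lt)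
... | inj₂ eq = inj₁ (sym eq)

-- Since some trace advances, all do once advancing and stalling traces
-- exclude each other.
synced-suc : ∀ {T τ j} → IsTef T τ → Synced T τ j →
             (∀ t t′ → τ (suc j) t ≡ j → τ (suc j) t′ ≢ suc j) → Synced T τ (suc j)
synced-suc {T} {τ} {j} tef sy excl t with tef-step {T} {τ} tef j t
... | inj₂ eq = trans eq (cong suc (sy t))
... | inj₁ eq = contradiction stall (proj₂ (proj₁ (tef j)))
  where
  stall : ∀ t′ → τ j t′ ≡ τ (suc j) t′
  stall t′ with tef-step {T} {τ} tef j t′
  ... | inj₁ eq′ = sym eq′
  ... | inj₂ eq′ = contradiction (trans eq′ (cong suc (sy t′))) (excl t t′ (trans eq (sy t)))

-- The trace `t₀` gives strictness and the value `i` at time `i` gives fairness, so both modes are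
-- covered.
synced-tef : ∀ m {T τ} → (∀ i → Synced T τ i) → Index T → Tef m T τ
synced-tef m {T} {τ} sy t₀ = tef m
  where
  ≤-suc : ∀ i → τ i ≤ᵛ τ (suc i)
  ≤-suc i t rewrite sy i t | sy (suc i) t = n≤1+n i
  isTef : IsTef T τ
  isTef i = (≤-suc i , λ eq → 1+n≢n (trans (sym (sy (suc i) t₀)) (trans (sym (eq t₀)) (sy i t₀)))) ,
            ≤-suc i ,
            λ t → ≤-reflexive (trans (sy (suc i) t) (trans (cong suc (sym (sy i t))) (+-comm 1 _)))
  tef : ∀ m → Tef m T τ
  tef unrestricted = isTef
  tef fair         = isTef , λ i t → i , ≤-reflexive (sym (sy i t))

agree-refl : ∀ {T i} (τ : TimeFunction T) → AgreeUpTo {T} i τ τ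
agree-refl τ j j≤i t = refl

synced-agree : ∀ {T τ τ′ i} → Synced T τ i → AgreeUpTo {T} i τ τ′ → Synced T τ′ i
synced-agree sy agree t = trans (agree _ ≤-refl t) (sy t)

≤-induction : ∀ {P : ℕ → Set} {i} → P i → (∀ k → i ≤ k → P k → P (suc k)) → ∀ k → i ≤ k → P k
≤-induction {P} {i} base step k i≤k = go (≤⇒≤′ i≤k)
  where
  go : ∀ {k} → i ≤′ k → P k
  go ≤′-refl       = base
  go (≤′-step i≤k) = step _ (≤′⇒≤ i≤k) (go i≤k)

synchronous-synced : ∀ {T τ} → IsTef T τ → Initial T τ → Synchronous T τ → ∀ i → Synced T τ i
synchronous-synced tef init syn zero = init
synchronous-synced {T} {τ} tef init syn (suc i) =
  synced-suc {T} {τ} tef (synchronous-synced {T} {τ} tef init syn i)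
    λ t t′ eq eq′ → 1+n≢n (trans (sym eq′) (trans (syn (suc i) t′ t) eq))

split-cases : ∀ {I : Set} (s : I → Bool) t {A : Set} → (s t ≡ true → A) → (s t ≡ false → A) → A
split-cases s t f g with s t
... | true  = f refl
... | false = g refl

-- Downward closure to one trace: a split puts `t` on one side, and temporal witnesses common to the
-- team also serve `t`.
⊨⇒holds : ∀ {m φ T τ i} (d : TeamLTL φ) → (∀ j → Synced T τ j) → ⟨ T , τ , i ⟩⊨[ m ] φ →
          ∀ t → holds d (trace T t) i
⊨⇒holds {T = T} {i = i} (pos p) sy h t = subst (λ n → trace T t n p ≡ true) (sy i t) (h t)
⊨⇒holds {T = T} {i = i} (neg p) sy h t = subst (λ n → trace T t n p ≡ false) (sy i t) (h t)
⊨⇒holds (d ∨ e) sy (s , h , h′) t = split-cases s t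
  (λ eq → inj₁ (⊨⇒holds d (λ j t → sy j (proj₁ t)) h (t , eq)))
  (λ eq → inj₂ (⊨⇒holds e (λ j t → sy j (proj₁ t)) h′ (t , eq)))
⊨⇒holds (d ∧ e) sy (h , h′) t = ⊨⇒holds d sy h t , ⊨⇒holds e sy h′ t
⊨⇒holds (X d) sy h t = ⊨⇒holds d sy h t
⊨⇒holds (d U e) sy (k , i≤k , h , h′) t =
  k , i≤k , ⊨⇒holds e sy h t , λ l i≤l l<k → ⊨⇒holds d sy (h′ l i≤l l<k) t
⊨⇒holds (d W e) sy h t k i≤k with h k i≤k
... | inj₁ h′                  = inj₁ (⊨⇒holds d sy h′ t)
... | inj₂ (l , i≤l , l≤k , h′) = inj₂ (l , i≤l , l≤k , ⊨⇒holds e sy h′ t)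

empty-⊨ : ∀ {m φ T τ i} (d : TeamLTL φ) → ¬ Index T → ⟨ T , τ , i ⟩⊨[ m ] φ
empty-⊨ (pos p) ¬t t = contradiction t ¬t
empty-⊨ (neg p) ¬t t = contradiction t ¬t
empty-⊨ (d ∨ e) ¬t =
  (λ _ → true) , empty-⊨ d (λ t → ¬t (proj₁ t)) , empty-⊨ e (λ t → ¬t (proj₁ t))
empty-⊨ (d ∧ e) ¬t = empty-⊨ d ¬t , empty-⊨ e ¬t
empty-⊨ (X d)   ¬t = empty-⊨ d ¬t
empty-⊨ (d U e) ¬t = _ , ≤-refl , empty-⊨ e ¬t , λ _ _ _ → empty-⊨ d ¬t
empty-⊨ (d W e) ¬t k i≤k = inj₁ (empty-⊨ d ¬t)

-- As all traces equal `u`, the whole team can go to one side of a split, leaving the other empty,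
-- and temporal witnesses are shared.
holds⇒⊨ : ∀ {m φ T τ u i} (d : TeamLTL φ) → (∀ t → trace T t ≡ u) → (∀ j → Synced T τ j) →
          holds d u i → ⟨ T , τ , i ⟩⊨[ m ] φ
holds⇒⊨ {i = i} (pos p) eq sy h t rewrite eq t | sy i t = h
holds⇒⊨ {i = i} (neg p) eq sy h t rewrite eq t | sy i t = h
holds⇒⊨ (d ∨ e) eq sy (inj₁ h) = (λ _ → true) ,
  holds⇒⊨ d (λ t → eq (proj₁ t)) (λ j t → sy j (proj₁ t)) h , empty-⊨ e λ ()
holds⇒⊨ (d ∨ e) eq sy (inj₂ h) = (λ _ → false) ,
  empty-⊨ d (λ ()) , holds⇒⊨ e (λ t → eq (proj₁ t)) (λ j t → sy j (proj₁ t)) h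
holds⇒⊨ (d ∧ e) eq sy (h , h′) = holds⇒⊨ d eq sy h , holds⇒⊨ e eq sy h′
holds⇒⊨ (X d)   eq sy h = holds⇒⊨ d eq sy h
holds⇒⊨ (d U e) eq sy (k , i≤k , h , h′) =
  k , i≤k , holds⇒⊨ e eq sy h , λ l i≤l l<k → holds⇒⊨ d eq sy (h′ l i≤l l<k)
holds⇒⊨ (d W e) eq sy h k i≤k with h k i≤k
... | inj₁ h′                  = inj₁ (holds⇒⊨ d eq sy h′)
... | inj₂ (l , i≤l , l≤k , h′) = inj₂ (l , i≤l , l≤k , holds⇒⊨ e eq sy h′)

sync-sat⇔ : ∀ m {φ} (d : TeamLTL φ) → Problem.Satisfiable (SyncTeamLTL-SAT m) φ ⇔ (∃[ u ] holds d u 0)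
sync-sat⇔ m d = mk⇔
  (λ (T , t , τ , tef , init , syn , h) →
    trace T t , ⊨⇒holds d (synchronous-synced {T} {τ} (tef⇒isTef m tef) init syn) h t)
  (λ (u , h) → let T = record { Index = ⊤ ; trace = λ _ → u } in
    T , tt , (λ i _ → i) , synced-tef m {T} (λ _ _ → refl) tt , (λ _ → refl) ,
    (λ _ _ _ → refl) , holds⇒⊨ d (λ _ → refl) (λ _ _ → refl) h)

-- The translations

-- The hole comes last in prefix notation, so filling it only prepends a constant word; this is what
-- makes the translations homomorphisms.
record Context : Set where
  field
    fill        : Formula → Formula
    prefix      : Word
    encode-fill : ∀ φ → encode (fill φ) ≡ prefix ++ encode φ

open Context

hole : Context
hole = record { fill = λ φ → φ ; prefix = [] ; encode-fill = λ _ → refl }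

infixr 6 _⟨∧⟩_ _⟨∨⟩_

_⟨∧⟩_ _⟨∨⟩_ : Formula → Context → Context
χ ⟨∧⟩ c = record
  { fill        = λ φ → χ ∧ fill c φ
  ; prefix      = ∧ˢ ∷ encode χ ++ prefix c
  ; encode-fill = λ φ → cong (∧ˢ ∷_)
      (trans (cong (encode χ ++_) (encode-fill c φ)) (sym (++-assoc (encode χ) _ _)))
  }
χ ⟨∨⟩ c = record
  { fill        = λ φ → χ ∨ fill c φ
  ; prefix      = ∨ˢ ∷ encode χ ++ prefix c
  ; encode-fill = λ φ → cong (∨ˢ ∷_)
      (trans (cong (encode χ ++_) (encode-fill c φ)) (sym (++-assoc (encode χ) _ _)))
  }

-- The proposition p becomes true ∷ p, so that [] and all false ∷ p are fresh.
module Translation (q : Quantifier) (top lit con : Context) where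

  tr : ∀ {φ} → TeamLTL φ → Formula
  tr (pos p) = fill lit (pos (true ∷ p))
  tr (neg p) = fill lit (neg (true ∷ p))
  tr (d ∨ e) = fill con (tr d ∨ tr e)
  tr (d ∧ e) = fill con (tr d ∧ tr e)
  tr (X d)   = fill con (quant q (X (tr d)))
  tr (d U e) = fill con (quant q (tr d U tr e))
  tr (d W e) = fill con (quant q (tr d W tr e))

  -- In encodings of TeamLTL formulae, `pos` and `neg` stand only right before a proposition, so the
  -- appended `bit true` performs the renaming.
  image : Symbol → Word
  image pos = prefix lit ++ pos ∷ bit true ∷ []
  image neg = prefix lit ++ neg ∷ bit true ∷ []
  image ∧ˢ  = prefix con ++ ∧ˢ ∷ []
  image ∨ˢ  = prefix con ++ ∨ˢ ∷ []
  image Xˢ  = prefix con ++ quant q ∷ Xˢ ∷ []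
  image Uˢ  = prefix con ++ quant q ∷ Uˢ ∷ []
  image Wˢ  = prefix con ++ quant q ∷ Wˢ ∷ []
  image a   = a ∷ []

  image-encodeAP : ∀ p → concatMap image (encodeAP p) ≡ encodeAP p
  image-encodeAP []      = refl
  image-encodeAP (b ∷ p) = cong (bit b ∷_) (image-encodeAP p)

  private
    literal-case : ∀ (c : Context) φ v {w w′} → w′ ≡ w → encode φ ≡ v ++ w →
                   encode (fill c φ) ≡ (prefix c ++ v) ++ w′
    literal-case c φ v refl eq =
      trans (encode-fill c φ) (trans (cong (prefix c ++_) eq) (sym (++-assoc (prefix c) v _)))

  encode-tr : ∀ {φ} (d : TeamLTL φ) → encode (tr d) ≡ concatMap image (encode φ)
  encode-tr₂ : ∀ {φ ψ} (d : TeamLTL φ) (e : TeamLTL ψ) →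
    concatMap image (encode φ ++ encode ψ) ≡ encode (tr d) ++ encode (tr e)
  encode-tr (pos p) = literal-case lit _ (pos ∷ bit true ∷ []) (image-encodeAP p) refl
  encode-tr (neg p) = literal-case lit _ (neg ∷ bit true ∷ []) (image-encodeAP p) refl
  encode-tr (d ∨ e) = literal-case con _ (∨ˢ ∷ []) (encode-tr₂ d e) refl
  encode-tr (d ∧ e) = literal-case con _ (∧ˢ ∷ []) (encode-tr₂ d e) refl
  encode-tr (X d)   = literal-case con _ (quant q ∷ Xˢ ∷ []) (sym (encode-tr d)) refl
  encode-tr (d U e) = literal-case con _ (quant q ∷ Uˢ ∷ []) (encode-tr₂ d e) refl
  encode-tr (d W e) = literal-case con _ (quant q ∷ Wˢ ∷ []) (encode-tr₂ d e) refl
  encode-tr₂ {φ} {ψ} d e = trans (concatMap-++ image (encode φ) (encode ψ))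
    (cong₂ _++_ (sym (encode-tr d)) (sym (encode-tr e)))

  tr-instance : ∀ {Q C} → q Unary.∈ Q →
    (∀ {χ} → TeamCTL Q C χ → TeamCTL Q C (fill lit χ)) →
    (∀ {χ} → TeamCTL Q C χ → TeamCTL Q C (fill con χ)) →
    ∀ {φ} (d : TeamLTL φ) → TeamCTL Q C (tr d)
  tr-instance {Q} {C} q∈Q lit-closed con-closed = go
    where
    go : ∀ {φ} (d : TeamLTL φ) → TeamCTL Q C (tr d)
    go (pos p) = lit-closed (pos _)
    go (neg p) = lit-closed (neg _)
    go (d ∨ e) = con-closed (go d ∨ go e)
    go (d ∧ e) = con-closed (go d ∧ go e)
    go (X d)   = con-closed (X q∈Q (go d))
    go (d U e) = con-closed (TeamCTL.U q∈Q (go d) (go e))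
    go (d W e) = con-closed (TeamCTL.W q∈Q (go d) (go e))

  open Homomorphism (prefix top) image

  -- The machine writes the prefix of `top` together with its first input symbol, hence the appeal
  -- to nonempty encodings.
  computes-tr : ∀ {φ} (d : TeamLTL φ) →
    Computes machine (encode φ) (encode (fill top (tr d))) (suc bound * length (encode φ))
  computes-tr {φ} d with encode φ in eq | encode-nonempty d
    where
    encode-nonempty : ∀ {φ} → TeamLTL φ → ∃[ a ] ∃[ w ] encode φ ≡ a ∷ w
    encode-nonempty (pos p) = _ , _ , refl
    encode-nonempty (neg p) = _ , _ , refl
    encode-nonempty (d ∨ e) = _ , _ , refl
    encode-nonempty (d ∧ e) = _ , _ , refl
    encode-nonempty (X d)   = _ , _ , refl
    encode-nonempty (d U e) = _ , _ , refl
    encode-nonempty (d W e) = _ , _ , refl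
  ... | .(a ∷ w) | a , w , refl = subst (λ v → Computes machine (a ∷ w) v (suc bound * length (a ∷ w)))
    (sym (trans (encode-fill top (tr d))
                (cong (prefix top ++_) (trans (encode-tr d) (cong (concatMap image) eq)))))
    (computes a w)

  reduction : ∀ {m Q} →
    (∀ {φ} (d : TeamLTL φ) → Problem.Instance Q (fill top (tr d))) →
    (∀ {φ} (d : TeamLTL φ) → (∃[ u ] holds d u 0) ⇔ Problem.Satisfiable Q (fill top (tr d))) →
    SyncTeamLTL-SAT m ≤ˡⁱⁿ Q
  reduction {m} inst sat = machine , suc bound , λ φ d →
    fill top (tr d) , inst d , computes-tr d ,
    mk⇔ (λ h → Equivalence.to (sat d) (Equivalence.to (sync-sat⇔ m d) h))
        (λ h → Equivalence.from (sync-sat⇔ m d) (Equivalence.from (sat d) h))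

-- Undoes the renaming of propositions.
fresh : Trace → Trace
fresh u n p = u n (true ∷ p)

marker clock : AP
marker = []
clock  = false ∷ []

-- Laid out so that `fresh` recovers `u` by computation; `b` is a constant marker and `c` the clock.
decorate : Bool → (ℕ → Bool) → Trace → Trace
decorate b c u n []          = b
decorate b c u n (false ∷ _) = c n
decorate b c u n (true ∷ p)  = u n p

-- Reduction to ∀TeamCTL

module UniversalCase (m : Mode) where

  open Translation all hole hole hole

  -- Each ∀ is instantiated by the synchronous `τ` itself, which is a tef because `t` inhabits the
  -- team.
  tr⇒holds : ∀ {φ T τ i} (d : TeamLTL φ) → (∀ j → Synced T τ j) → ⟨ T , τ , i ⟩⊨[ m ] tr d →
             ∀ t → holds d (fresh (trace T t)) i
  tr⇒holds {T = T} {i = i} (pos p) sy h t = subst (λ n → trace T t n (true ∷ p) ≡ true) (sy i t) (h t)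
  tr⇒holds {T = T} {i = i} (neg p) sy h t = subst (λ n → trace T t n (true ∷ p) ≡ false) (sy i t) (h t)
  tr⇒holds (d ∨ e) sy (s , h , h′) t = split-cases s t
    (λ eq → inj₁ (tr⇒holds d (λ j t → sy j (proj₁ t)) h (t , eq)))
    (λ eq → inj₂ (tr⇒holds e (λ j t → sy j (proj₁ t)) h′ (t , eq)))
  tr⇒holds (d ∧ e) sy (h , h′) t = tr⇒holds d sy h t , tr⇒holds e sy h′ t
  tr⇒holds {T = T} {τ} (X d) sy h t = tr⇒holds d sy (h τ (synced-tef m {T} sy t) (agree-refl {T} τ)) t
  tr⇒holds {T = T} {τ} (d U e) sy h t with h τ (synced-tef m {T} sy t) (agree-refl {T} τ)
  ... | k , i≤k , h , h′ =
    k , i≤k , tr⇒holds e sy h t , λ l i≤l l<k → tr⇒holds d sy (h′ l i≤l l<k) t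
  tr⇒holds {T = T} {τ} (d W e) sy h t k i≤k
    with h τ (synced-tef m {T} sy t) (agree-refl {T} τ) k i≤k
  ... | inj₁ h′                  = inj₁ (tr⇒holds d sy h′ t)
  ... | inj₂ (l , i≤l , l≤k , h′) = inj₂ (l , i≤l , l≤k , tr⇒holds e sy h′ t)

  -- At most one trace: unlike exactly one, this is inherited by both sides of a split.
  IsSingle : Team → Set
  IsSingle T = (t t′ : Index T) → t ≡ t′

  ↾-single : ∀ {T} → IsSingle T → ∀ s b → IsSingle (T ↾ s ∷= b)
  ↾-single single s b (t , eq) (t′ , eq′) with single t t′
  ↾-single single s b (t , refl) (.t , refl) | refl = refl

  single-synced : ∀ {T τ i} → IsSingle T → IsTef T τ → Synced T τ i → ∀ j → i ≤ j → Synced T τ j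
  single-synced {T} {τ} single tef sy = ≤-induction sy λ j _ sy′ → synced-suc {T} {τ} tef sy′
    λ t t′ eq eq′ → 1+n≢n (trans (sym eq′) (trans (cong (τ (suc j)) (single t′ t)) eq))

  empty-tr : ∀ {φ T τ i} (d : TeamLTL φ) → ¬ Index T → ⟨ T , τ , i ⟩⊨[ m ] tr d
  empty-tr (pos p) ¬t t = contradiction t ¬t
  empty-tr (neg p) ¬t t = contradiction t ¬t
  empty-tr (d ∨ e) ¬t =
    (λ _ → true) , empty-tr d (λ t → ¬t (proj₁ t)) , empty-tr e (λ t → ¬t (proj₁ t))
  empty-tr (d ∧ e) ¬t = empty-tr d ¬t , empty-tr e ¬t
  empty-tr (X d)   ¬t τ′ tef agree = empty-tr d ¬t
  empty-tr (d U e) ¬t τ′ tef agree = _ , ≤-refl , empty-tr e ¬t , λ _ _ _ → empty-tr d ¬t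
  empty-tr (d W e) ¬t τ′ tef agree k i≤k = inj₁ (empty-tr d ¬t)

  -- Synchrony is assumed at `i` alone, since a quantified tef agrees with `τ` only up to `i`;
  -- `single-synced` supplies later times.
  holds⇒tr : ∀ {φ T τ i u} (d : TeamLTL φ) → IsSingle T → (∀ t → fresh (trace T t) ≡ u) →
             Synced T τ i → holds d u i → ⟨ T , τ , i ⟩⊨[ m ] tr d
  holds⇒tr (pos p) single eq sy h t rewrite sym (eq t) | sy t = h
  holds⇒tr (neg p) single eq sy h t rewrite sym (eq t) | sy t = h
  holds⇒tr {T = T} (d ∨ e) single eq sy (inj₁ h) = (λ _ → true) ,
    holds⇒tr d (↾-single {T} single _ _) (λ t → eq (proj₁ t)) (λ t → sy (proj₁ t)) h ,
    empty-tr e λ ()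
  holds⇒tr {T = T} (d ∨ e) single eq sy (inj₂ h) = (λ _ → false) ,
    empty-tr d (λ ()) ,
    holds⇒tr e (↾-single {T} single _ _) (λ t → eq (proj₁ t)) (λ t → sy (proj₁ t)) h
  holds⇒tr (d ∧ e) single eq sy (h , h′) = holds⇒tr d single eq sy h , holds⇒tr e single eq sy h′
  holds⇒tr {T = T} {τ} {i} (X d) single eq sy h τ′ tef agree =
    holds⇒tr d single eq (synced-later (suc i) (n≤1+n i)) h
    where
    synced-later = single-synced {T} single (tef⇒isTef m tef) (synced-agree {T} {τ} sy agree)
  holds⇒tr {T = T} {τ} (d U e) single eq sy (k , i≤k , h , h′) τ′ tef agree =
    k , i≤k , holds⇒tr e single eq (synced-later k i≤k) h ,
    λ l i≤l l<k → holds⇒tr d single eq (synced-later l i≤l) (h′ l i≤l l<k)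
    where
    synced-later = single-synced {T} single (tef⇒isTef m tef) (synced-agree {T} {τ} sy agree)
  holds⇒tr {T = T} {τ} (d W e) single eq sy h τ′ tef agree k i≤k
    with single-synced {T} single (tef⇒isTef m tef) (synced-agree {T} {τ} sy agree) | h k i≤k
  ... | synced-later | inj₁ h′ = inj₁ (holds⇒tr d single eq (synced-later k i≤k) h′)
  ... | synced-later | inj₂ (l , i≤l , l≤k , h′) =
    inj₂ (l , i≤l , l≤k , holds⇒tr e single eq (synced-later l i≤l) h′)

  ∀-reduction : ∀ C → SyncTeamLTL-SAT m ≤ˡⁱⁿ ∀TeamCTL-SAT m C
  ∀-reduction C = reduction
    (tr-instance refl (λ χ → χ) (λ χ → χ))
    (λ d → mk⇔
      (λ (u , h) → record { Index = ⊤ ; trace = λ _ → decorate false (λ _ → false) u } , tt ,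
        λ τ tef init → holds⇒tr d (λ _ _ → refl) (λ _ → refl) init h)
      (λ (T , t , h) → fresh (trace T t) ,
        tr⇒holds d (λ _ _ → refl)
          (h (λ i _ → i) (synced-tef m {T} (λ _ _ → refl) t) (λ _ → refl)) t))

-- Clocks and dummy traces

literal : Bool → AP → Formula
literal true  = pos
literal false = neg

-- Contradictory on nonempty teams only; there `χ W falsum` says that `χ` holds from now on.
falsum : Formula
falsum = pos marker ∧ neg marker

G : Formula → Formula
G χ = quant some (χ W falsum)

G-instance : ∀ {C χ} → ∃TeamCTL C χ → ∃TeamCTL C (G χ)
G-instance χ = TeamCTL.W refl χ (pos _ ∧ neg _)

flip : Bool → Formula
flip b = literal b clock ∧ quant some (X (literal (Bool.not b) clock))

FlipsAt : (ℕ → Bool) → ℕ → Set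
FlipsAt c n = c (suc n) ≡ Bool.not (c n)

Flips : (ℕ → Bool) → Set
Flips c = ∀ n → FlipsAt c n

even : ℕ → Bool
even zero    = true
even (suc n) = Bool.not (even n)

module Operators (m : Mode) where

  ⊨-literal : ∀ T τ i p b → (∀ t → trace T t (τ i t) p ≡ b) → ⟨ T , τ , i ⟩⊨[ m ] literal b p
  ⊨-literal T τ i p true  h = h
  ⊨-literal T τ i p false h = h

  ⊨-literal⁻¹ : ∀ T τ i p b → ⟨ T , τ , i ⟩⊨[ m ] literal b p → ∀ t → trace T t (τ i t) p ≡ b
  ⊨-literal⁻¹ T τ i p true  h = h
  ⊨-literal⁻¹ T τ i p false h = h

  ⊨-G : ∀ T τ i χ → Tef m T τ → (∀ k → i ≤ k → ⟨ T , τ , k ⟩⊨[ m ] χ) → ⟨ T , τ , i ⟩⊨[ m ] G χ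
  ⊨-G T τ i χ tef h = τ , tef , agree-refl {T} τ , λ k i≤k → inj₁ (h k i≤k)

  ⊨-G⁻¹ : ∀ T τ i χ → Index T → ⟨ T , τ , i ⟩⊨[ m ] G χ →
          ∃[ τ′ ] Tef m T τ′ × AgreeUpTo {T} i τ τ′ × (∀ k → i ≤ k → ⟨ T , τ′ , k ⟩⊨[ m ] χ)
  ⊨-G⁻¹ T τ i χ t (τ′ , tef , agree , h) = τ′ , tef , agree , always
    where
    always : ∀ k → i ≤ k → ⟨ T , τ′ , k ⟩⊨[ m ] χ
    always k i≤k with h k i≤k
    ... | inj₁ h′                           = h′
    ... | inj₂ (l , _ , _ , true≡ , false≡) = contradiction (trans (sym (true≡ t)) (false≡ t)) λ ()

  ⊨-flip : ∀ T τ i b → (∀ j → Synced T τ j) → Index T →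
           (∀ t → trace T t i clock ≡ b) → (∀ t → trace T t (suc i) clock ≡ Bool.not b) →
           ⟨ T , τ , i ⟩⊨[ m ] flip b
  ⊨-flip T τ i b sy t h h′ =
    ⊨-literal T τ i clock b (λ t → trans (cong (λ n → trace T t n clock) (sy i t)) (h t)) ,
    τ , synced-tef m {T} sy t , agree-refl {T} τ ,
    ⊨-literal T τ (suc i) clock (Bool.not b)
      (λ t → trans (cong (λ n → trace T t n clock) (sy (suc i) t)) (h′ t))

  -- A stalling trace would see its clock unchanged, against the second conjunct; so every trace
  -- advances, and its next position carries the flipped value.
  ⊨-flip⁻¹ : ∀ T τ i b → ⟨ T , τ , i ⟩⊨[ m ] flip b → ∀ t →
             trace T t (τ i t) clock ≡ b × FlipsAt (⟦ var clock ⟧ (trace T t)) (τ i t)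
  ⊨-flip⁻¹ T τ i b (h , τ′ , tef , agree , h′) t
    with ⊨-literal⁻¹ T τ i clock b h t | ⊨-literal⁻¹ T τ′ (suc i) clock (Bool.not b) h′ t
       | tef-step {T} (tef⇒isTef m tef) i t
  ... | now | later | inj₁ eq rewrite eq | agree i ≤-refl t = contradiction later (not-¬ now)
  ... | now | later | inj₂ eq rewrite eq | agree i ≤-refl t = now , trans later (cong Bool.not (sym now))

-- Provides `A` at all times before the witness: synchrony at a time rests on clock agreement at all
-- earlier times, which a bare witness of W does not give.
first-witness : ∀ {A B : ℕ → Set} {i} →
  (∀ k → i ≤ k → A k ⊎ (∃[ l ] i ≤ l × l ≤ k × B l)) → ∀ k → i ≤ k →
  (∀ l → i ≤ l → l ≤ k → A l) ⊎
  (∃[ l ] i ≤ l × l ≤ k × B l × (∀ n → i ≤ n → n < l → A n))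
first-witness {A} {B} {i} h = ≤-induction base next-goal
  where
  Goal : ℕ → Set
  Goal k = (∀ l → i ≤ l → l ≤ k → A l) ⊎
           (∃[ l ] i ≤ l × l ≤ k × B l × (∀ n → i ≤ n → n < l → A n))
  base : Goal i
  base with h i ≤-refl
  ... | inj₁ a = inj₁ λ l i≤l l≤i → subst A (≤-antisym i≤l l≤i) a
  ... | inj₂ (l , i≤l , l≤i , b) =
    inj₂ (l , i≤l , l≤i , b , λ n i≤n n<l → contradiction (≤-trans n<l l≤i) (≤⇒≯ i≤n))
  next-goal : ∀ k → i ≤ k → Goal k → Goal (suc k)
  next-goal k i≤k (inj₂ (l , i≤l , l≤k , w)) = inj₂ (l , i≤l , m≤n⇒m≤1+n l≤k , w)
  next-goal k i≤k (inj₁ as) with h (suc k) (m≤n⇒m≤1+n i≤k)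
  ... | inj₁ a = inj₁ λ l i≤l l≤1+k → extend l i≤l (m≤n⇒m<n∨m≡n l≤1+k)
    where
    extend : ∀ l → i ≤ l → l < suc k ⊎ l ≡ suc k → A l
    extend l i≤l (inj₁ l<1+k) = as l i≤l (s≤s⁻¹ l<1+k)
    extend l i≤l (inj₂ refl)  = a
  ... | inj₂ (l , i≤l , l≤1+k , b) =
    inj₂ (l , i≤l , l≤1+k , b , λ n i≤n n<l → as n i≤n (s≤s⁻¹ (≤-trans n<l l≤1+k)))

-- If one trace stalled and another advanced, their clocks, equal before the step, would differ
-- after it, as only one has flipped.
synced-flip : ∀ {T τ j} (key : Index T → ℕ → Bool) → IsTef T τ → Synced T τ j →
  (∀ t → key t (suc j) ≡ Bool.not (key t j)) →
  (∀ t t′ → key t (τ j t) ≡ key t′ (τ j t′)) →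
  (∀ t t′ → key t (τ (suc j) t) ≡ key t′ (τ (suc j) t′)) → Synced T τ (suc j)
synced-flip {T} {τ} {j} key tef sy flips now later = synced-suc {T} tef sy λ t t′ eq eq′ →
  let open ≡-Reasoning in
  not-¬ {key t j} refl (begin
    key t j                    ≡⟨ cong (key t) eq ⟨
    key t (τ (suc j) t)        ≡⟨ later t t′ ⟩
    key t′ (τ (suc j) t′)      ≡⟨ cong (key t′) eq′ ⟩
    key t′ (suc j)             ≡⟨ flips t′ ⟩
    Bool.not (key t′ j)        ≡⟨ cong (λ n → Bool.not (key t′ n)) (sy t′) ⟨
    Bool.not (key t′ (τ j t′)) ≡⟨ cong Bool.not (now t′ t) ⟩
    Bool.not (key t (τ j t))   ≡⟨ cong (λ n → Bool.not (key t n)) (sy t) ⟩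
    Bool.not (key t j)         ∎)

-- κ is a clock that flips at every position once check holds, and σ makes all
-- traces of a team agree on it.  Since an ∃-modality fails on the empty team,
-- both sides of a splitting are kept nonempty by dummy traces, which carry the
-- marker at all positions and on which literals are vacuous.
module ExistentialCase (m : Mode) (C : Pred Extension 0ℓ)
  (κ : PropFormula) (σ check : Formula) (phase : Bool → ℕ → Bool)
  (σ-instance : ∃TeamCTL C σ) (check-instance : ∃TeamCTL C check)
  (⊨-σ : ∀ T τ i b → (∀ t → ⟦ κ ⟧ (trace T t) (τ i t) ≡ b) → ⟨ T , τ , i ⟩⊨[ m ] σ)
  (⊨-σ⁻¹ : ∀ T τ i → ⟨ T , τ , i ⟩⊨[ m ] σ →
           ∀ t t′ → ⟦ κ ⟧ (trace T t) (τ i t) ≡ ⟦ κ ⟧ (trace T t′) (τ i t′))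
  (κ-decorate : ∀ b u n → ⟦ κ ⟧ (decorate b (phase b) u) n ≡ even n)
  (⊨-check : ∀ T τ u (dummy : Index T → Bool) →
             (∀ t → trace T t ≡ decorate (dummy t) (phase (dummy t)) u) →
             (∀ j → Synced T τ j) → (∀ b → ∃[ t ] dummy t ≡ b) → ⟨ T , τ , 0 ⟩⊨[ m ] check)
  (⊨-check⁻¹ : ∀ T τ → Synced T τ 0 → ⟨ T , τ , 0 ⟩⊨[ m ] check →
               (∀ t → Flips (⟦ κ ⟧ (trace T t))) × (∃[ t ] ∀ n → trace T t n marker ≡ false))
  where

  open Operators m
  open Translation some (check ⟨∧⟩ hole) (σ ⟨∧⟩ pos marker ⟨∨⟩ hole) (σ ⟨∧⟩ hole)

  Agreed : (T : Team) → TimeFunction T → ℕ → Set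
  Agreed T τ i = ∀ t t′ → ⟦ κ ⟧ (trace T t) (τ i t) ≡ ⟦ κ ⟧ (trace T t′) (τ i t′)

  -- Both contexts used inside `tr` begin with `σ`.
  tr-agreed : ∀ {φ T τ i} (d : TeamLTL φ) → ⟨ T , τ , i ⟩⊨[ m ] tr d → Agreed T τ i
  tr-agreed (pos p) h = ⊨-σ⁻¹ _ _ _ (proj₁ h)
  tr-agreed (neg p) h = ⊨-σ⁻¹ _ _ _ (proj₁ h)
  tr-agreed (d ∨ e) h = ⊨-σ⁻¹ _ _ _ (proj₁ h)
  tr-agreed (d ∧ e) h = ⊨-σ⁻¹ _ _ _ (proj₁ h)
  tr-agreed (X d)   h = ⊨-σ⁻¹ _ _ _ (proj₁ h)
  tr-agreed (d U e) h = ⊨-σ⁻¹ _ _ _ (proj₁ h)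
  tr-agreed (d W e) h = ⊨-σ⁻¹ _ _ _ (proj₁ h)

  module _ {T : Team} (flips : ∀ t → Flips (⟦ κ ⟧ (trace T t))) where

    agreed-synced : ∀ {τ i} → IsTef T τ → Synced T τ i → ∀ k → i ≤ k →
      (∀ l → i ≤ l → l ≤ k → Agreed T τ l) → Synced T τ k
    agreed-synced {τ} {i} tef sy = ≤-induction (λ _ → sy) λ k i≤k ih agreed →
      synced-flip {T} (λ t → ⟦ κ ⟧ (trace T t)) tef
        (ih λ l i≤l l≤k → agreed l i≤l (m≤n⇒m≤1+n l≤k))
        (λ t → flips t k) (agreed k i≤k (n≤1+n k)) (agreed (suc k) (m≤n⇒m≤1+n i≤k) ≤-refl)

    until-synced : ∀ {τ i k} → IsTef T τ → Synced T τ i → i ≤ k →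
      (∀ l → i ≤ l → l < k → Agreed T τ l) → Agreed T τ k → ∀ l → i ≤ l → l ≤ k → Synced T τ l
    until-synced {τ} {i} {k} tef sy i≤k agreed last l i≤l l≤k =
      agreed-synced {τ} tef sy l i≤l λ n i≤n n≤l → all-agreed n i≤n (m≤n⇒m<n∨m≡n (≤-trans n≤l l≤k))
      where
      all-agreed : ∀ n → i ≤ n → n < k ⊎ n ≡ k → Agreed T τ n
      all-agreed n i≤n (inj₁ n<k)  = agreed n i≤n n<k
      all-agreed n i≤n (inj₂ refl) = last

  -- Marked traces may satisfy literals vacuously, so `d` is claimed only for traces that are never
  -- marked; dummies still take part in the synchronisation.
  tr⇒holds : ∀ {φ T τ i} (d : TeamLTL φ) → (∀ t → Flips (⟦ κ ⟧ (trace T t))) →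
    Synced T τ i → ⟨ T , τ , i ⟩⊨[ m ] tr d →
    ∀ t → (∀ n → trace T t n marker ≡ false) → holds d (fresh (trace T t)) i
  tr⇒holds {T = T} (pos p) flips sy (_ , s , h , h′) t real = split-cases s t
    (λ eq → contradiction (trans (sym (h (t , eq))) (real _)) λ ())
    (λ eq → subst (λ n → trace T t n (true ∷ p) ≡ true) (sy t) (h′ (t , eq)))
  tr⇒holds {T = T} (neg p) flips sy (_ , s , h , h′) t real = split-cases s t
    (λ eq → contradiction (trans (sym (h (t , eq))) (real _)) λ ())
    (λ eq → subst (λ n → trace T t n (true ∷ p) ≡ false) (sy t) (h′ (t , eq)))
  tr⇒holds (d ∨ e) flips sy (_ , s , h , h′) t real = split-cases s t
    (λ eq → inj₁ (tr⇒holds d (λ t → flips (proj₁ t)) (λ t → sy (proj₁ t)) h (t , eq) real))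
    (λ eq → inj₂ (tr⇒holds e (λ t → flips (proj₁ t)) (λ t → sy (proj₁ t)) h′ (t , eq) real))
  tr⇒holds (d ∧ e) flips sy (_ , h , h′) t real =
    tr⇒holds d flips sy h t real , tr⇒holds e flips sy h′ t real
  tr⇒holds {T = T} {τ} {i} (X d) flips sy (agr , τ′ , tef , agree , h) t real =
    tr⇒holds d flips (synced (suc i) (n≤1+n i) ≤-refl) h t real
    where
    -- `σ` was asserted at `τ`, which coincides with `τ′` up to `i`.
    σ-now : Agreed T τ′ i
    σ-now t t′ = trans (cong (⟦ κ ⟧ (trace T t)) (agree i ≤-refl t))
      (trans (⊨-σ⁻¹ T τ i agr t t′) (cong (⟦ κ ⟧ (trace T t′)) (sym (agree i ≤-refl t′))))
    synced = until-synced {T} flips {τ′} (tef⇒isTef m tef) (synced-agree {T} {τ} sy agree) (n≤1+n i)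
      (λ l i≤l l≤i → subst (Agreed T τ′) (≤-antisym i≤l (s≤s⁻¹ l≤i)) σ-now) (tr-agreed d h)
  tr⇒holds {T = T} {τ} {i} (d U e) flips sy (_ , τ′ , tef , agree , k , i≤k , h , h′) t real =
    k , i≤k , tr⇒holds e flips (synced k i≤k ≤-refl) h t real ,
    λ l i≤l l<k → tr⇒holds d flips (synced l i≤l (<⇒≤ l<k)) (h′ l i≤l l<k) t real
    where
    synced = until-synced {T} flips {τ′} (tef⇒isTef m tef) (synced-agree {T} {τ} sy agree) i≤k
      (λ l i≤l l<k → tr-agreed d (h′ l i≤l l<k)) (tr-agreed e h)
  tr⇒holds {T = T} {τ} {i} (d W e) flips sy (_ , τ′ , tef , agree , h) t real k i≤k
    with synced-agree {T} {τ} {τ′} sy agree | first-witness h k i≤k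
  ... | sy′ | inj₁ as = inj₁ (tr⇒holds d flips
    (agreed-synced {T} flips {τ′} (tef⇒isTef m tef) sy′ k i≤k
      λ l i≤l l≤k → tr-agreed d (as l i≤l l≤k))
    (as k i≤k ≤-refl) t real)
  ... | sy′ | inj₂ (l , i≤l , l≤k , b , as) = inj₂ (l , i≤l , l≤k , tr⇒holds e flips
    (until-synced {T} flips {τ′} (tef⇒isTef m tef) sy′ i≤l
      (λ n i≤n n<l → tr-agreed d (as n i≤n n<l)) (tr-agreed e b) l i≤l ≤-refl)
    b t real)

  -- The dummies form a full binary tree, whose two subtrees supply the two
  -- sides of a splitting.
  record Supplied (u : Trace) (T : Team) : Set where
    field
      dummy       : Index T → Bool
      decorated   : ∀ t → trace T t ≡ decorate (dummy t) (phase (dummy t)) u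
      label       : Index T → List Bool
      supply      : List Bool → Index T
      dummy-supply : ∀ w → dummy (supply w) ≡ true
      label-supply : ∀ w → label (supply w) ≡ w

    inhabitant : Index T
    inhabitant = supply []

  open Supplied

  head : List Bool → Bool
  head []      = true
  head (b ∷ _) = b

  tail : List Bool → List Bool
  tail []      = []
  tail (_ ∷ w) = w

  -- A dummy goes to the side named by the first letter of its label; all other traces go to side
  -- `b`.
  side : ∀ {u T} → Supplied u T → Bool → Index T → Bool
  side S b t = Bool.if dummy S t then head (label S t) else b

  ↾-supplied : ∀ {u T} (S : Supplied u T) b c → Supplied u (T ↾ side S b ∷= c)
  ↾-supplied S b c = record
    { dummy        = λ t → dummy S (proj₁ t)
    ; decorated    = λ t → decorated S (proj₁ t)
    ; label        = λ t → tail (label S (proj₁ t))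
    ; supply       = λ w → supply S (c ∷ w) , on-side w
    ; dummy-supply = λ w → dummy-supply S (c ∷ w)
    ; label-supply = λ w → cong tail (label-supply S (c ∷ w))
    }
    where
    on-side : ∀ w → side S b (supply S (c ∷ w)) ≡ c
    on-side w rewrite dummy-supply S (c ∷ w) | label-supply S (c ∷ w) = refl

  off-side-dummy : ∀ {u T} (S : Supplied u T) b t → side S b t ≡ Bool.not b → dummy S t ≡ true
  off-side-dummy S b t eq with dummy S t
  ... | true  = refl
  ... | false = contradiction eq (not-¬ refl)

  supplied-σ : ∀ {u T τ i} → Supplied u T → (∀ j → Synced T τ j) → ⟨ T , τ , i ⟩⊨[ m ] σ
  supplied-σ {u} {T} {τ} {i} S sy = ⊨-σ T τ i (even i) λ t →
    trans (cong₂ ⟦ κ ⟧ (decorated S t) (sy i t)) (κ-decorate (dummy S t) u i)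

  supplied-literal : ∀ {u T τ i p b} (S : Supplied u T) → (∀ j → Synced T τ j) →
    (∀ t → dummy S t ≡ true) ⊎ u i p ≡ b →
    ⟨ T , τ , i ⟩⊨[ m ] (pos marker ∨ literal b (true ∷ p))
  supplied-literal {u} {T} {τ} {i} {p} {b} S sy h = dummy S ,
    (λ (t , eq) → trans (cong (λ v → v (τ i t) marker) (decorated S t)) eq) ,
    ⊨-literal (T ↾ dummy S ∷= false) (restrict {T} τ (dummy S) false) i _ b λ (t , eq) →
      trans (cong₂ (λ v n → v n (true ∷ p)) (decorated S t) (sy i t)) (real t eq h)
    where
    real : ∀ t → dummy S t ≡ false → (∀ t → dummy S t ≡ true) ⊎ u i p ≡ b → u i p ≡ b
    real t eq (inj₁ dummies) = contradiction (trans (sym (dummies t)) eq) λ ()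
    real t eq (inj₂ h)       = h

  -- A team of dummies alone plays the part of the empty team: it satisfies every translation, and
  -- yet it has tefs.
  holds⇒tr : ∀ {φ u T τ i} (d : TeamLTL φ) (S : Supplied u T) → (∀ j → Synced T τ j) →
    (∀ t → dummy S t ≡ true) ⊎ holds d u i → ⟨ T , τ , i ⟩⊨[ m ] tr d
  holds⇒tr (pos p) S sy h = supplied-σ S sy , supplied-literal S sy h
  holds⇒tr (neg p) S sy h = supplied-σ S sy , supplied-literal S sy h
  holds⇒tr (d ∨ e) S sy (inj₁ dummies) = supplied-σ S sy , side S true ,
    holds⇒tr d (↾-supplied S true true) (λ j t → sy j (proj₁ t)) (inj₁ λ t → dummies (proj₁ t)) ,
    holds⇒tr e (↾-supplied S true false) (λ j t → sy j (proj₁ t)) (inj₁ λ t → dummies (proj₁ t))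
  holds⇒tr (d ∨ e) S sy (inj₂ (inj₁ h)) = supplied-σ S sy , side S true ,
    holds⇒tr d (↾-supplied S true true) (λ j t → sy j (proj₁ t)) (inj₂ h) ,
    holds⇒tr e (↾-supplied S true false) (λ j t → sy j (proj₁ t))
      (inj₁ λ (t , eq) → off-side-dummy S true t eq)
  holds⇒tr (d ∨ e) S sy (inj₂ (inj₂ h)) = supplied-σ S sy , side S false ,
    holds⇒tr d (↾-supplied S false true) (λ j t → sy j (proj₁ t))
      (inj₁ λ (t , eq) → off-side-dummy S false t eq) ,
    holds⇒tr e (↾-supplied S false false) (λ j t → sy j (proj₁ t)) (inj₂ h)
  holds⇒tr (d ∧ e) S sy (inj₁ dummies) =
    supplied-σ S sy , holds⇒tr d S sy (inj₁ dummies) , holds⇒tr e S sy (inj₁ dummies)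
  holds⇒tr (d ∧ e) S sy (inj₂ (h , h′)) =
    supplied-σ S sy , holds⇒tr d S sy (inj₂ h) , holds⇒tr e S sy (inj₂ h′)
  holds⇒tr {T = T} {τ} (X d) S sy h = supplied-σ S sy ,
    τ , synced-tef m {T} sy (inhabitant S) , agree-refl {T} τ , holds⇒tr d S sy h
  holds⇒tr {T = T} {τ} (d U e) S sy h = supplied-σ S sy ,
    τ , synced-tef m {T} sy (inhabitant S) , agree-refl {T} τ , until h
    where
    until : _ → ⟨ T , τ , _ ⟩⊨[ m ] (tr d U tr e)
    until (inj₁ dummies) =
      _ , ≤-refl , holds⇒tr e S sy (inj₁ dummies) , λ _ _ _ → holds⇒tr d S sy (inj₁ dummies)
    until (inj₂ (k , i≤k , h , h′)) =
      k , i≤k , holds⇒tr e S sy (inj₂ h) , λ l i≤l l<k → holds⇒tr d S sy (inj₂ (h′ l i≤l l<k))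
  holds⇒tr {T = T} {τ} (d W e) S sy h = supplied-σ S sy ,
    τ , synced-tef m {T} sy (inhabitant S) , agree-refl {T} τ , weakUntil h
    where
    weakUntil : _ → ⟨ T , τ , _ ⟩⊨[ m ] (tr d W tr e)
    weakUntil (inj₁ dummies) k i≤k = inj₁ (holds⇒tr d S sy (inj₁ dummies))
    weakUntil (inj₂ h) k i≤k with h k i≤k
    ... | inj₁ h′                  = inj₁ (holds⇒tr d S sy (inj₂ h′))
    ... | inj₂ (l , i≤l , l≤k , h′) = inj₂ (l , i≤l , l≤k , holds⇒tr e S sy (inj₂ h′))

  -- `nothing` is the one real trace, `just w` the dummy with label `w`.
  model : Trace → Team
  model u = record
    { Index = Maybe (List Bool)
    ; trace = λ t → decorate (is-just t) (phase (is-just t)) u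
    }

  model-supplied : ∀ u → Supplied u (model u)
  model-supplied u = record
    { dummy        = is-just
    ; decorated    = λ _ → refl
    ; label        = fromMaybe []
    ; supply       = just
    ; dummy-supply = λ _ → refl
    ; label-supply = λ _ → refl
    }

  ∃-reduction : SyncTeamLTL-SAT m ≤ˡⁱⁿ ∃TeamCTL-SAT m C
  ∃-reduction = reduction
    (λ d → check-instance ∧ tr-instance refl (λ χ → σ-instance ∧ (pos _ ∨ χ)) (σ-instance ∧_) d)
    (λ d → mk⇔
      (λ (u , h) → model u , nothing , (λ i _ → i) ,
        synced-tef m {model u} (λ _ _ → refl) nothing , (λ _ → refl) ,
        ⊨-check (model u) (λ i _ → i) u is-just (λ _ → refl) (λ _ _ → refl)
          (λ { true → just [] , refl ; false → nothing , refl }) ,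
        holds⇒tr d (model-supplied u) (λ _ _ → refl) (inj₂ h))
      (λ (T , _ , τ , _ , init , h , h′) →
        let flips , t , real = ⊨-check⁻¹ T τ init h in
        fresh (trace T t) , tr⇒holds d flips init h′ t real))

-- Reduction to ∃TeamCTL with Boolean disjunction

module BooleanCase (em : ExcludedMiddle 0ℓ) where

  open Operators unrestricted

  -- Through `∨ᴮ` all traces of a class agree on the clock, so the marked and the unmarked class are
  -- each synchronised on their own.
  σ anyFlip check : Formula
  σ = pos clock ∨ᴮ neg clock
  anyFlip = flip true ∨ᴮ flip false
  check = G (anyFlip ∧ pos marker) ∨ G (anyFlip ∧ neg marker)

  ⊨-anyFlip⁻¹ : ∀ {T τ i} → ⟨ T , τ , i ⟩⊨[ unrestricted ] anyFlip → ∃[ b ] ∀ t →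
    trace T t (τ i t) clock ≡ b × FlipsAt (⟦ var clock ⟧ (trace T t)) (τ i t)
  ⊨-anyFlip⁻¹ {T} {τ} (inj₁ h) = true , ⊨-flip⁻¹ T τ _ true h
  ⊨-anyFlip⁻¹ {T} {τ} (inj₂ h) = false , ⊨-flip⁻¹ T τ _ false h

  ⊨-anyFlip : ∀ T τ i b → (∀ j → Synced T τ j) → Index T →
    (∀ t → trace T t i clock ≡ b) → (∀ t → trace T t (suc i) clock ≡ Bool.not b) →
    ⟨ T , τ , i ⟩⊨[ unrestricted ] anyFlip
  ⊨-anyFlip T τ i true  sy t h h′ = inj₁ (⊨-flip T τ i true sy t h h′)
  ⊨-anyFlip T τ i false sy t h h′ = inj₂ (⊨-flip T τ i false sy t h h′)

  -- Flipping is known only at positions visited by `τ′`. Synchrony at `n` identifies the visited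
  -- position as `n`, and flipping there yields synchrony at `suc n`.
  class-sound : ∀ T τ b → Synced T τ 0 →
    ⟨ T , τ , 0 ⟩⊨[ unrestricted ] G (anyFlip ∧ literal b marker) →
    ∀ t → Flips (⟦ var clock ⟧ (trace T t)) × (∀ n → trace T t n marker ≡ b)
  class-sound T τ b sy h t₀
    with ⊨-G⁻¹ T τ 0 (anyFlip ∧ literal b marker) t₀ h
  ... | τ′ , tef , agree , always = (λ n → flips n (synced n) t₀) , λ n →
    subst (λ k → trace T t₀ k marker ≡ b) (synced n t₀)
      (⊨-literal⁻¹ T τ′ n marker b (proj₂ (always n z≤n)) t₀)
    where
    flips-all : ∀ n → ∃[ b ] ∀ t →
      trace T t (τ′ n t) clock ≡ b × FlipsAt (⟦ var clock ⟧ (trace T t)) (τ′ n t)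
    flips-all n = ⊨-anyFlip⁻¹ {T} {τ′} {n} (proj₁ (always n z≤n))
    flips : ∀ n → Synced T τ′ n → ∀ t → FlipsAt (⟦ var clock ⟧ (trace T t)) n
    flips n sy′ t = subst (FlipsAt (⟦ var clock ⟧ (trace T t))) (sy′ t)
      (proj₂ (proj₂ (flips-all n) t))
    agreed : ∀ n t t′ → trace T t (τ′ n t) clock ≡ trace T t′ (τ′ n t′) clock
    agreed n t t′ = trans (proj₁ (proj₂ (flips-all n) t)) (sym (proj₁ (proj₂ (flips-all n) t′)))
    synced : ∀ n → Synced T τ′ n
    synced zero    = synced-agree {T} {τ} sy agree
    synced (suc n) = synced-flip {T} (λ t → ⟦ var clock ⟧ (trace T t)) tef (synced n)
      (flips n (synced n)) (agreed n) (agreed (suc n))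

  check-sound : ∀ T τ → Synced T τ 0 → ⟨ T , τ , 0 ⟩⊨[ unrestricted ] check →
    (∀ t → Flips (⟦ var clock ⟧ (trace T t))) × (∃[ t ] ∀ n → trace T t n marker ≡ false)
  check-sound T τ sy (s , h , h′) =
    (λ t → split-cases s t (λ eq → proj₁ (marked (t , eq))) (λ eq → proj₁ (unmarked (t , eq)))) ,
    -- The modality in `G` provides a tef, so the unmarked class is nonempty.
    let t = tef-nonempty em {T ↾ s ∷= false} (proj₁ (proj₂ h′)) in
    proj₁ t , proj₂ (unmarked t)
    where
    marked   = class-sound (T ↾ s ∷= true) (restrict {T} τ s true) true (λ t → sy (proj₁ t)) h
    unmarked = class-sound (T ↾ s ∷= false) (restrict {T} τ s false) false (λ t → sy (proj₁ t)) h′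

  check-complete : ∀ T τ u (dummy : Index T → Bool) →
    (∀ t → trace T t ≡ decorate (dummy t) even u) →
    (∀ j → Synced T τ j) → (∀ b → ∃[ t ] dummy t ≡ b) → ⟨ T , τ , 0 ⟩⊨[ unrestricted ] check
  check-complete T τ u dummy decorated sy inhabited = dummy , class true , class false
    where
    class : ∀ b → ⟨ T ↾ dummy ∷= b , restrict {T} τ dummy b , 0 ⟩⊨[ unrestricted ]
                  G (anyFlip ∧ literal b marker)
    class b = ⊨-G (T ↾ dummy ∷= b) τ′ 0 (anyFlip ∧ literal b marker)
      (synced-tef unrestricted {T ↾ dummy ∷= b} (λ j t → sy j (proj₁ t)) (inhabited b))
      λ k _ →
        ⊨-anyFlip (T ↾ dummy ∷= b) τ′ k (even k) (λ j t → sy j (proj₁ t)) (inhabited b)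
          (λ (t , _) → cong (λ v → v k clock) (decorated t))
          (λ (t , _) → cong (λ v → v (suc k) clock) (decorated t)) ,
        ⊨-literal (T ↾ dummy ∷= b) τ′ k marker b
          λ (t , eq) → trans (cong (λ v → v (τ k t) marker) (decorated t)) eq
      where
      τ′ = restrict {T} τ dummy b

  anyFlip-instance : ∃TeamCTL ｛ booleanDisjunction ｝ anyFlip
  anyFlip-instance = or refl (pos _ ∧ X refl (neg _)) (neg _ ∧ X refl (pos _))

  σ-complete : ∀ T τ i b → (∀ t → trace T t (τ i t) clock ≡ b) → ⟨ T , τ , i ⟩⊨[ unrestricted ] σ
  σ-complete T τ i true  h = inj₁ h
  σ-complete T τ i false h = inj₂ h

  σ-sound : ∀ T τ i → ⟨ T , τ , i ⟩⊨[ unrestricted ] σ →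
            ∀ t t′ → trace T t (τ i t) clock ≡ trace T t′ (τ i t′) clock
  σ-sound T τ i (inj₁ h) t t′ = trans (h t) (sym (h t′))
  σ-sound T τ i (inj₂ h) t t′ = trans (h t) (sym (h t′))

  open ExistentialCase unrestricted ｛ booleanDisjunction ｝ (var clock) σ check (λ _ → even)
    (or refl (pos _) (neg _))
    (G-instance (anyFlip-instance ∧ pos _) ∨ G-instance (anyFlip-instance ∧ neg _))
    σ-complete σ-sound (λ _ _ _ → refl) check-complete check-sound
    public using (∃-reduction)

-- Fair tefs and the reduction to ∃TeamCTL with dependence atoms

-- A discrete intermediate value argument: `τ` starts at zero, grows by at most one per step and is
-- unbounded on `t` by fairness, so it skips no position.
fair-visits : ∀ {T τ} → IsTef T τ → Fair T τ → Synced T τ 0 → ∀ t n → ∃[ j ] τ j t ≡ n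
fair-visits {T} {τ} tef fairness sy t zero = 0 , sy t
fair-visits {T} {τ} tef fairness sy t (suc n) with fairness (suc n) t
... | j , n<τj = descend j n<τj
  where
  descend : ∀ j → suc n ≤ τ j t → ∃[ k ] τ k t ≡ suc n
  descend zero    n<τ0 = contradiction (≤-trans n<τ0 (≤-reflexive (sy t))) λ ()
  descend (suc j) n<τ with tef-step {T} tef j t | m≤n⇒m<n∨m≡n n<τ
  ... | _       | inj₂ eq   = suc j , sym eq
  ... | inj₁ eq | inj₁ _    = descend j (≤-trans n<τ (≤-reflexive eq))
  ... | inj₂ eq | inj₁ 1+n< = descend j (s≤s⁻¹ (≤-trans 1+n< (≤-reflexive eq)))

-- Without ∨ᴮ the two cases of a flip must be joined by a splitting with both
-- sides nonempty, so the clocks of dummies run in antiphase, for which κ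
-- compensates.  Fairness makes G reach every position of every trace.
module DependenceCase (em : ExcludedMiddle 0ℓ) where

  open Operators fair

  -- Exclusive or of clock and marker.
  κ : PropFormula
  κ = (var clock ∧ not (var marker)) ∨ (not (var clock) ∧ var marker)

  σ check : Formula
  σ = dep [] κ
  check = (G (pos marker) ∨ G (neg marker)) ∧ G (flip true ∨ flip false)

  -- The tef chosen for `G` may be asynchronous, but being fair it visits every position of every
  -- trace.
  G-everywhere : ∀ T τ χ (P : Trace → ℕ → Set) →
    (∀ τ i → ⟨ T , τ , i ⟩⊨[ fair ] χ → ∀ t → P (trace T t) (τ i t)) →
    Synced T τ 0 → ⟨ T , τ , 0 ⟩⊨[ fair ] G χ → ∀ t n → P (trace T t) n
  G-everywhere T τ χ P sound sy h t n with ⊨-G⁻¹ T τ 0 χ t h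
  ... | τ′ , (tef , fairness) , agree , always =
    let j , eq = fair-visits {T} tef fairness (synced-agree {T} {τ} sy agree) t n in
    subst (P (trace T t)) eq (sound τ′ j (always j z≤n) t)

  flips-sound : ∀ T τ i → ⟨ T , τ , i ⟩⊨[ fair ] (flip true ∨ flip false) →
                ∀ t → FlipsAt (⟦ var clock ⟧ (trace T t)) (τ i t)
  flips-sound T τ i (s , h , h′) t = split-cases s t
    (λ eq → proj₂ (⊨-flip⁻¹ (T ↾ s ∷= true) (restrict {T} τ s true) i true h (t , eq)))
    (λ eq → proj₂ (⊨-flip⁻¹ (T ↾ s ∷= false) (restrict {T} τ s false) i false h′ (t , eq)))

  -- With the marker constant along the trace, flipping the clock flips the exclusive or.
  κ-flips : ∀ v b → Flips (⟦ var clock ⟧ v) → (∀ n → v n marker ≡ b) → Flips (⟦ κ ⟧ v)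
  κ-flips v b flips constant n rewrite flips n | constant (suc n) | constant n = xor-not (v n clock) b
    where
    xor-not : ∀ a b → (Bool.not a Bool.∧ Bool.not b) Bool.∨ (Bool.not (Bool.not a) Bool.∧ b) ≡
                      Bool.not ((a Bool.∧ Bool.not b) Bool.∨ (Bool.not a Bool.∧ b))
    xor-not true  true  = refl
    xor-not true  false = refl
    xor-not false true  = refl
    xor-not false false = refl

  check-sound : ∀ T τ → Synced T τ 0 → ⟨ T , τ , 0 ⟩⊨[ fair ] check →
    (∀ t → Flips (⟦ κ ⟧ (trace T t))) × (∃[ t ] ∀ n → trace T t n marker ≡ false)
  check-sound T τ sy ((s , h , h′) , h″) =
    (λ t → split-cases s t
      (λ eq → κ-flips (trace T t) true (flips t) (class true h (t , eq)))
      (λ eq → κ-flips (trace T t) false (flips t) (class false h′ (t , eq)))) ,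
    let t = tef-nonempty em {T ↾ s ∷= false} (proj₁ (proj₁ (proj₂ h′))) in
    proj₁ t , class false h′ t
    where
    flips : ∀ t → Flips (⟦ var clock ⟧ (trace T t))
    flips = G-everywhere T τ (flip true ∨ flip false) (λ v → FlipsAt (⟦ var clock ⟧ v))
      (flips-sound T) sy h″
    class : ∀ b → ⟨ T ↾ s ∷= b , restrict {T} τ s b , 0 ⟩⊨[ fair ] G (literal b marker) →
            ∀ t n → trace T (proj₁ t) n marker ≡ b
    class b = G-everywhere (T ↾ s ∷= b) (restrict {T} τ s b) (literal b marker)
      (λ v n → v n marker ≡ b) (λ τ i → ⊨-literal⁻¹ (T ↾ s ∷= b) τ i marker b) (λ t → sy (proj₁ t))

  phase : Bool → ℕ → Bool
  phase b n = even n Bool.xor b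

  check-complete : ∀ T τ u (dummy : Index T → Bool) →
    (∀ t → trace T t ≡ decorate (dummy t) (phase (dummy t)) u) →
    (∀ j → Synced T τ j) → (∀ b → ∃[ t ] dummy t ≡ b) → ⟨ T , τ , 0 ⟩⊨[ fair ] check
  check-complete T τ u dummy decorated sy inhabited =
    (dummy , class true , class false) ,
    ⊨-G T τ 0 (flip true ∨ flip false) (synced-tef fair {T} sy (proj₁ (inhabited true))) λ k _ →
      -- The split is by current clock value; because of the antiphase both halves are inhabited at
      -- every time.
      (λ t → phase (dummy t) k) , half k true , half k false
    where
    class : ∀ b → ⟨ T ↾ dummy ∷= b , restrict {T} τ dummy b , 0 ⟩⊨[ fair ] G (literal b marker)
    class b = ⊨-G (T ↾ dummy ∷= b) (restrict {T} τ dummy b) 0 (literal b marker)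
      (synced-tef fair {T ↾ dummy ∷= b} (λ j t → sy j (proj₁ t)) (inhabited b))
      λ k _ → ⊨-literal (T ↾ dummy ∷= b) (restrict {T} τ dummy b) k marker b
        λ (t , eq) → trans (cong (λ v → v (τ k t) marker) (decorated t)) eq
    xor-inverse : ∀ a b → a Bool.xor (a Bool.xor b) ≡ b
    xor-inverse true  b = not-involutive b
    xor-inverse false b = refl
    xor-notˡ : ∀ a b → Bool.not a Bool.xor b ≡ Bool.not (a Bool.xor b)
    xor-notˡ true  b = sym (not-involutive b)
    xor-notˡ false b = refl
    half : ∀ k b → ⟨ T ↾ (λ t → phase (dummy t) k) ∷= b ,
                     restrict {T} τ (λ t → phase (dummy t) k) b , k ⟩⊨[ fair ] flip b
    half k b = ⊨-flip (T ↾ s ∷= b) (restrict {T} τ s b) k b (λ j t → sy j (proj₁ t))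
      -- `even k xor b` solves `even k xor x = b` for `x`, so a trace of this kind shows clock value
      -- `b` at time `k`.
      (let t , eq = inhabited (even k Bool.xor b) in
       t , trans (cong (even k Bool.xor_) eq) (xor-inverse (even k) b))
      (λ (t , eq) → trans (cong (λ v → v k clock) (decorated t)) eq)
      (λ (t , eq) → trans (cong (λ v → v (suc k) clock) (decorated t))
        (trans (xor-notˡ (even k) (dummy t)) (cong Bool.not eq)))
      where
      s : Index T → Bool
      s t = phase (dummy t) k

  κ-decorate : ∀ b u n → ⟦ κ ⟧ (decorate b (phase b) u) n ≡ even n
  κ-decorate b u n = xor-cancel (even n) b
    where
    xor-cancel : ∀ a b → ((a Bool.xor b) Bool.∧ Bool.not b) Bool.∨ (Bool.not (a Bool.xor b) Bool.∧ b) ≡ a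
    xor-cancel true  true  = refl
    xor-cancel true  false = refl
    xor-cancel false true  = refl
    xor-cancel false false = refl

  open ExistentialCase fair ｛ dependence ｝ κ σ check phase
    (dep refl [] κ)
    ((G-instance (pos _) ∨ G-instance (neg _)) ∧
      G-instance ((pos _ ∧ X refl (neg _)) ∨ (neg _ ∧ X refl (pos _))))
    -- A dependence atom without premises states constancy of `κ` over the team.
    (λ T τ i b h t t′ _ → trans (h t) (sym (h t′))) (λ T τ i h t t′ → h t t′ [])
    κ-decorate check-complete check-sound
    public using (∃-reduction)

theorem4p4 : ExcludedMiddle 0ℓ →
    (SyncTeamLTL-SAT unrestricted ≤ˡⁱⁿ ∃TeamCTL-SAT unrestricted ｛ booleanDisjunction ｝) ×
    (SyncTeamLTL-SAT unrestricted ≤ˡⁱⁿ ∀TeamCTL-SAT unrestricted ｛ inclusion ｝) ×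
    (SyncTeamLTL-SAT fair ≤ˡⁱⁿ ∃TeamCTL-SAT fair ｛ dependence ｝)
theorem4p4 em =
  BooleanCase.∃-reduction em ,
  UniversalCase.∀-reduction unrestricted ｛ inclusion ｝ ,
  DependenceCase.∃-reduction em
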